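{- Let $n\ge 4$. Consider the board obtained from the $C_n$ board (a cycle graph with $n$ vertices embedded in the plane) by adding one internal chord connecting two non-adjacent vertices of the cycle, so that the board has two bounded cells. In the Game of Cycles on this board, if $n$ is even then Player~1 has a winning strategy, and if $n$ is odd then Player~2 has a winning strategy.
   Context: The Game of Cycles. A board is a simple connected planar graph embedded in the plane, together with its bounded cells. Two players alternate turns; on a turn a player marks one unmarked edge with an arrow pointing along the edge in one of its two directions. Each edge receives at most one arrow, and arrows have the same effect regardless of who placed them. Moves must obey the sink-source rule: no move may create a sink (a vertex all of whose incident edges are marked with arrows pointing toward it) or a source (a vertex all of whose incident edges are marked with arrows pointing away from it). A player who has a legal move must make one. A cycle cell is a bounded cell all of whose boundary edges are marked with arrows all cycling in the same direction around that cell. The first player to create a cycle cell wins; if play ends (no legal move remains) without a cycle cell, the player who made the last move wins. A winning strategy guarantees a win regardless of the opponent's moves. -}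

module Defs where

open import Data.Bool.Base using (if_then_else_; _∧_)
open import Data.Empty using (⊥-elim)
open import Data.Fin.Base as Fin using (Fin; zero; suc; toℕ; fromℕ<)
open import Data.Fin.Properties as Finₚ
  using (_≟_; toℕ<n; toℕ-injective; toℕ-fromℕ<)
open import Data.List.Base using (List; []; _∷_)
open import Data.List.Membership.Propositional using (_∈_; _∉_)
open import Data.Maybe.Base using (Maybe; just; nothing)
open import Data.Nat.Base as ℕ using (ℕ; zero; suc; _+_; _≤_; _<_; z≤n; s≤s)
open import Data.Nat.DivMod using (_mod_; _%_; m%n<n; m<n⇒m%n≡m; n%n≡0; [m+n]%n≡m%n)
import Data.Nat.Properties as ℕₚ
open import Data.Product.Base using (_×_; _,_; ∃-syntax; Σ-syntax; proj₁; proj₂)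
open import Data.Sum.Base using (_⊎_; inj₁; inj₂)
open import Function.Base using (_∘_)
open import Relation.Binary.Construct.Closure.ReflexiveTransitive
  using (Star; ε; _◅_; _◅◅_; reverse)
open import Relation.Binary.PropositionalEquality
open import Relation.Nullary using (¬_; yes; no; does; contradiction)
open import Relation.Nullary.Decidable using (dec-true; dec-false)

data Direction : Set where
  fwd bwd : Direction

flip : Direction → Direction
flip fwd = bwd
flip bwd = fwd

-- `Orbit f x y` says y = fᵏ x for some k.
Orbit : {A : Set} → (A → A) → A → A → Set
Orbit f = Star (λ x y → f x ≡ y)

-- A simple connected plane graph, up to homeomorphism, presented as a
-- combinatorial map.  A dart is an edge with a chosen direction; it stands
-- both for one side of the edge and for an arrow along it.  The edges are
-- directed arbitrarily by `fwd`.
--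
-- `next d` is the dart following d on the boundary of the cell to which d
-- belongs, so the cells are the orbits of `next`; the darts leaving a vertex
-- are cyclically permuted by `next ∘ rev`.  Planarity is Euler's formula.
-- As every cell has a dart, the one-vertex graph (on which there are no moves)
-- is not covered.
record Board : Set where
  field
    #V #E #C : ℕ

  Dart : Set
  Dart = Fin #E × Direction

  rev : Dart → Dart
  rev (e , s) = e , flip s

  field
    src : Dart → Fin #V

  tgt : Dart → Fin #V
  tgt d = src (rev d)

  field
    loopless  : ∀ d → src d ≢ tgt d
    simple    : ∀ d d′ → src d ≡ src d′ → tgt d ≡ tgt d′ → d ≡ d′
    connected : ∀ u v → Star (λ x y → ∃[ d ] (src d ≡ x × tgt d ≡ y)) u v

    next     : Dart → Dart
    next-src : ∀ d → src (next d) ≡ tgt d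
    rotation : ∀ d d′ → src d ≡ src d′ → Orbit (next ∘ rev) d d′

    -- Cell `zero` is the unbounded one; the bounded cells are `suc c`.
    cell       : Dart → Fin (suc #C)
    cell-next  : ∀ d → cell (next d) ≡ cell d
    cell-orbit : ∀ d d′ → cell d ≡ cell d′ → Orbit next d d′
    cell-onto  : ∀ c → ∃[ d ] cell d ≡ c

    euler : #V + suc #C ≡ #E + 2

data Player : Set where
  player₁ player₂ : Player

opponent : Player → Player
opponent player₁ = player₂
opponent player₂ = player₁

module Game (B : Board) where
  open Board B

  -- The moves made so far, most recent first.  `d ∈ h` says that the edge of d
  -- carries an arrow from `src d` to `tgt d`.
  History : Set
  History = List Dart

  Sink Source : History → Fin #V → Set
  Sink   h v = ∀ d → tgt d ≡ v → d ∈ h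
  Source h v = ∀ d → src d ≡ v → d ∈ h

  record Legal (h : History) (d : Dart) : Set where
    constructor legal
    field
      unmarked : d ∉ h × rev d ∉ h
      noSink   : ∀ v → ¬ Sink   (d ∷ h) v
      noSource : ∀ v → ¬ Source (d ∷ h) v

  CycleCell : History → Fin #C → Set
  CycleCell h c = (∀ d → cell d ≡ suc c → d ∈ h)
                ⊎ (∀ d → cell d ≡ suc c → rev d ∈ h)

  Finished : History → Set
  Finished h = (∃[ c ] CycleCell h c) ⊎ (∀ d → ¬ Legal h d)

  toMove : History → Player
  toMove []      = player₁
  toMove (_ ∷ h) = opponent (toMove h)

  lastMover : History → Maybe Player
  lastMover []      = nothing
  lastMover (_ ∷ h) = just (toMove h)

  Strategy : Set
  Strategy = History → Dart

  -- The histories that can arise when p follows σ and the opponent makes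
  -- arbitrary legal moves.  Play stops as soon as the game is finished.
  data Arises (p : Player) (σ : Strategy) : History → Set where
    start    : Arises p σ []
    own      : ∀ {h} → Arises p σ h → ¬ Finished h → toMove h ≡ p →
               Legal h (σ h) → Arises p σ (σ h ∷ h)
    opposing : ∀ {h d} → Arises p σ h → ¬ Finished h → toMove h ≡ opponent p →
               Legal h d → Arises p σ (d ∷ h)

  -- Whether play ended by a cycle cell or for lack of a legal move, the winner
  -- is whoever moved last.  Every play ends, as each move marks a new edge.
  record Winning (p : Player) (σ : Strategy) : Set where
    field
      canMove : ∀ {h} → Arises p σ h → ¬ Finished h → toMove h ≡ p → Legal h (σ h)
      wins    : ∀ {h} → Arises p σ h → Finished h → lastMover h ≡ just p

HasWinningStrategy : Board → Player → Set
HasWinningStrategy B p = ∃[ σ ] Game.Winning B p σ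

-- Cyclic successor and predecessor.
succ pred : ∀ {n} → Fin n → Fin n
succ {suc m} i = suc (toℕ i) mod suc m
pred {suc m} i = (toℕ i + m) mod suc m

-- Adjacency in the cycle graph Cₙ, whose edges join i and succ i.
CycleAdjacent : ∀ {n} → Fin n → Fin n → Set
CycleAdjacent i j = j ≡ succ i ⊎ i ≡ succ j

toℕ-mod : ∀ k m → toℕ (k mod suc m) ≡ k % suc m
toℕ-mod k m = toℕ-fromℕ< (m%n<n k (suc m))

succ-view : ∀ {n} (i : Fin n) →
  toℕ (succ i) ≡ suc (toℕ i) ⊎ (suc (toℕ i) ≡ n × toℕ (succ i) ≡ 0)
succ-view {suc m} i with ℕₚ.m≤n⇒m<n∨m≡n (toℕ<n i)
... | inj₁ lt = inj₁ (trans (toℕ-mod (suc (toℕ i)) m) (m<n⇒m%n≡m lt))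
... | inj₂ eq = inj₂ (eq , trans (toℕ-mod (suc (toℕ i)) m)
                             (trans (cong (_% suc m) eq) (n%n≡0 (suc m))))

pred-view : ∀ {n} (i : Fin n) →
  suc (toℕ (pred i)) ≡ toℕ i ⊎ (toℕ i ≡ 0 × suc (toℕ (pred i)) ≡ n)
pred-view {suc m} zero = inj₂ (refl , cong suc
  (trans (toℕ-mod m m) (m<n⇒m%n≡m (ℕₚ.n<1+n m))))
pred-view {suc m} (suc i) = inj₁ (cong suc (begin
  toℕ ((suc (toℕ i) + m) mod suc m) ≡⟨ toℕ-mod (suc (toℕ i) + m) m ⟩
  (suc (toℕ i) + m) % suc m         ≡⟨ cong (_% suc m) (sym (ℕₚ.+-suc (toℕ i) m)) ⟩
  (toℕ i + suc m) % suc m           ≡⟨ [m+n]%n≡m%n (toℕ i) (suc m) ⟩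
  toℕ i % suc m                     ≡⟨ m<n⇒m%n≡m (ℕₚ.m≤n⇒m≤1+n (toℕ<n i)) ⟩
  toℕ i                             ∎))
  where open ≡-Reasoning

succ-pred : ∀ {n} (i : Fin n) → succ (pred i) ≡ i
succ-pred i with pred-view i | succ-view (pred i)
... | inj₁ p       | inj₁ q       = toℕ-injective (trans q p)
... | inj₁ p       | inj₂ (q , _) =
  ⊥-elim (ℕₚ.<-irrefl (trans (sym p) q) (toℕ<n i))
... | inj₂ (_ , p) | inj₁ q       =
  ⊥-elim (ℕₚ.<-irrefl (trans q p) (toℕ<n (succ (pred i))))
... | inj₂ (p , _) | inj₂ (_ , q) = toℕ-injective (trans q (sym p))

succ-injective : ∀ {n} {i j : Fin n} → succ i ≡ succ j → i ≡ j
succ-injective {_} {i} {j} eq with succ-view i | succ-view j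
... | inj₁ p       | inj₁ q       =
  toℕ-injective (ℕₚ.suc-injective (trans (sym p) (trans (cong toℕ eq) q)))
... | inj₁ p       | inj₂ (_ , q) =
  contradiction (trans (sym p) (trans (cong toℕ eq) q)) λ ()
... | inj₂ (_ , p) | inj₁ q       =
  contradiction (trans (sym q) (trans (cong toℕ (sym eq)) p)) λ ()
... | inj₂ (p , _) | inj₂ (q , _) =
  toℕ-injective (ℕₚ.suc-injective (trans p (sym q)))

succ-< : ∀ {n} {i j : Fin n} → toℕ i < toℕ j → toℕ (succ i) ≡ suc (toℕ i)
succ-< {_} {i} {j} lt with succ-view i
... | inj₁ p       = p
... | inj₂ (p , _) = ⊥-elim (ℕₚ.<⇒≱ (toℕ<n j) (subst (_≤ toℕ j) p lt))

climb : ∀ {n} {A : Set} {R : A → A → Set} (f : Fin n → A) (i j : Fin n) →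
  toℕ i ≤ toℕ j →
  (∀ k → toℕ i ≤ toℕ k → toℕ k < toℕ j → Star R (f k) (f (succ k))) →
  Star R (f i) (f j)
climb {n} {A} {R} f i j i≤j step = go (toℕ j ℕ.∸ toℕ i) i (ℕₚ.m∸n+n≡m i≤j) ℕₚ.≤-refl
  where
  go : ∀ k (l : Fin n) → k + toℕ l ≡ toℕ j → toℕ i ≤ toℕ l → Star R (f l) (f j)
  go zero    l eq _   = subst (λ x → Star R (f l) (f x)) (toℕ-injective eq) ε
  go (suc k) l eq i≤l =
    step l i≤l l<j ◅◅
    go k (succ l)
       (trans (cong (k +_) sl) (trans (ℕₚ.+-suc k (toℕ l)) eq))
       (ℕₚ.≤-trans i≤l (subst (toℕ l ≤_) (sym sl) (ℕₚ.n≤1+n _)))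
    where
    l<j : toℕ l < toℕ j
    l<j = subst (toℕ l <_) eq (s≤s (ℕₚ.m≤n+m (toℕ l) k))
    sl = succ-< {i = l} {j} l<j

-- The Cₙ board with an internal chord joining a and b.  The vertices
-- 0, …, n-1 are in cyclic order around the outside.  The chord is directed
-- forwards from a to b, and the cycle edge `side i` from i to succ i.
-- Cell 1 is bounded by the sides a, …, b-1 and the chord (backwards), cell 2 by
-- the remaining sides and the chord (forwards).
module ChordBoard (n : ℕ) (a b : Fin n) (a<b : a Fin.< b)
                  (nonadjacent : ¬ CycleAdjacent a b) where

  pattern chord s  = zero , s
  pattern side i s = suc i , s

  Dart : Set
  Dart = Fin (suc n) × Direction

  src : Dart → Fin n
  src (chord fwd)  = a
  src (chord bwd)  = b
  src (side i fwd) = i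
  src (side i bwd) = succ i

  -- The dart following, on an inner cell, a side that arrives at v.
  depart : Fin n → Dart
  depart v = if does (v ≟ a) then chord fwd
             else if does (v ≟ b) then chord bwd
             else side v fwd

  next : Dart → Dart
  next (chord fwd)  = side b fwd
  next (chord bwd)  = side a fwd
  next (side i fwd) = depart (succ i)
  next (side i bwd) = side (pred i) bwd

  cell : Dart → Fin 3
  cell (chord fwd)  = suc (suc zero)
  cell (chord bwd)  = suc zero
  cell (side i fwd) = if does (a Finₚ.≤? i) ∧ does (i Finₚ.<? b)
                      then suc zero else suc (suc zero)
  cell (side i bwd) = zero

  rev : Dart → Dart
  rev (e , s) = e , flip s

  a≢b : a ≢ b
  a≢b eq = ℕₚ.<-irrefl (cong toℕ eq) a<b

  depart-a : depart a ≡ chord fwd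
  depart-a rewrite dec-true (a ≟ a) refl = refl

  depart-b : depart b ≡ chord bwd
  depart-b rewrite dec-false (b ≟ a) (a≢b ∘ sym) | dec-true (b ≟ b) refl = refl

  depart-side : ∀ {v} → v ≢ a → v ≢ b → depart v ≡ side v fwd
  depart-side {v} p q rewrite dec-false (v ≟ a) p | dec-false (v ≟ b) q = refl

  data Place (v : Fin n) : Set where
    at-a : v ≡ a → Place v
    at-b : v ≡ b → Place v
    off  : v ≢ a → v ≢ b → Place v

  place : ∀ v → Place v
  place v with v ≟ a | v ≟ b
  ... | yes p | _     = at-a p
  ... | no _  | yes q = at-b q
  ... | no p  | no q  = off p q

  src-depart : ∀ v → src (depart v) ≡ v
  src-depart v with place v
  ... | at-a refl = cong src depart-a
  ... | at-b refl = cong src depart-b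
  ... | off p q   = cong src (depart-side p q)

  <⇒≢ : ∀ {i j : Fin n} → toℕ i < toℕ j → i ≢ j
  <⇒≢ lt refl = ℕₚ.<-irrefl refl lt

  >⇒≢ : ∀ {i j : Fin n} → toℕ j < toℕ i → i ≢ j
  >⇒≢ lt refl = ℕₚ.<-irrefl refl lt

  inside : ∀ {i} → toℕ a ≤ toℕ i → toℕ i < toℕ b → cell (side i fwd) ≡ suc zero
  inside {i} p q rewrite dec-true (a Finₚ.≤? i) p | dec-true (i Finₚ.<? b) q = refl

  below : ∀ {i} → toℕ i < toℕ a → cell (side i fwd) ≡ suc (suc zero)
  below {i} p rewrite dec-false (a Finₚ.≤? i) (ℕₚ.<⇒≱ p) = refl

  above : ∀ {i} → toℕ b ≤ toℕ i → cell (side i fwd) ≡ suc (suc zero)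
  above {i} p rewrite dec-true (a Finₚ.≤? i) (ℕₚ.≤-trans (ℕₚ.<⇒≤ a<b) p)
                    | dec-false (i Finₚ.<? b) (ℕₚ.≤⇒≯ p) = refl

  data Arc (i : Fin n) : Set where
    low  : toℕ i < toℕ a → Arc i
    mid  : toℕ a ≤ toℕ i → toℕ i < toℕ b → Arc i
    high : toℕ b ≤ toℕ i → Arc i

  arc : ∀ i → Arc i
  arc i with toℕ a ℕₚ.≤? toℕ i | toℕ i ℕₚ.<? toℕ b
  ... | no p  | _     = low (ℕₚ.≰⇒> p)
  ... | yes p | yes q = mid p q
  ... | yes _ | no q  = high (ℕₚ.≮⇒≥ q)

  -- The cell of `depart v`, by the position of v.
  depart-mid : ∀ {v} → toℕ a < toℕ v → toℕ v ≤ toℕ b → cell (depart v) ≡ suc zero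
  depart-mid {v} p q with place v
  ... | at-a refl = ⊥-elim (ℕₚ.<-irrefl refl p)
  ... | at-b refl = cong cell depart-b
  ... | off x y   = trans (cong cell (depart-side x y))
    (inside (ℕₚ.<⇒≤ p) (ℕₚ.≤∧≢⇒< q (y ∘ toℕ-injective)))

  depart-low : ∀ {v} → toℕ v ≤ toℕ a → cell (depart v) ≡ suc (suc zero)
  depart-low {v} p with place v
  ... | at-a refl = cong cell depart-a
  ... | at-b refl = ⊥-elim (ℕₚ.<⇒≱ a<b p)
  ... | off x y   = trans (cong cell (depart-side x y))
    (below (ℕₚ.≤∧≢⇒< p (x ∘ toℕ-injective)))

  depart-high : ∀ {v} → toℕ b < toℕ v → cell (depart v) ≡ suc (suc zero)
  depart-high p = trans
    (cong cell (depart-side (>⇒≢ (ℕₚ.<-trans a<b p)) (>⇒≢ p))) (above (ℕₚ.<⇒≤ p))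

  cell-next : ∀ d → cell (next d) ≡ cell d
  cell-next (chord fwd)  = above ℕₚ.≤-refl
  cell-next (chord bwd)  = inside ℕₚ.≤-refl a<b
  cell-next (side i bwd) = refl
  cell-next (side i fwd) with arc i
  ... | low p = trans (depart-low (subst (_≤ toℕ a) (sym (succ-< {j = a} p)) p))
                      (sym (below p))
  ... | mid p q = trans
    (depart-mid (subst (toℕ a <_) (sym si) (s≤s p)) (subst (_≤ toℕ b) (sym si) q))
    (sym (inside p q))
    where si = succ-< {j = b} q
  ... | high p with succ-view i
  ... | inj₁ q       = trans (depart-high (subst (toℕ b <_) (sym q) (s≤s p)))
                             (sym (above p))
  ... | inj₂ (_ , q) = trans (depart-low (subst (_≤ toℕ a) (sym q) z≤n))
                             (sym (above p))

  cell-onto : ∀ c → ∃[ d ] cell d ≡ c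
  cell-onto zero             = side a bwd , refl
  cell-onto (suc zero)       = chord bwd , refl
  cell-onto (suc (suc zero)) = chord fwd , refl

  infix 4 _↝_
  _↝_ : Dart → Dart → Set
  _↝_ = Orbit next

  via : ∀ {d d′} → next d ≡ d′ → d ↝ d′
  via p = p ◅ ε

  -- Moving along the sides strictly inside an arc.
  depart-step : ∀ {k} → k ≢ a → k ≢ b → depart k ↝ depart (succ k)
  depart-step p q = via (cong next (depart-side p q))

  depart-climb : ∀ i j → toℕ i ≤ toℕ j →
    (∀ k → toℕ i ≤ toℕ k → toℕ k < toℕ j → k ≢ a × k ≢ b) → depart i ↝ depart j
  depart-climb i j i≤j ok = climb depart i j i≤j
    λ k p q → depart-step (proj₁ (ok k p q)) (proj₂ (ok k p q))

  bottom : Σ[ z ∈ Fin n ] toℕ z ≡ 0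
  bottom = fromℕ< 0<n , toℕ-fromℕ< 0<n
    where 0<n = ℕₚ.≤-<-trans z≤n (toℕ<n a)

  o = proj₁ bottom
  o≡0 = proj₂ bottom

  o≤ : ∀ {i : Fin n} → toℕ o ≤ toℕ i
  o≤ {i} = subst (_≤ toℕ i) (sym o≡0) z≤n

  top = pred o

  top≡ : suc (toℕ top) ≡ n
  top≡ with pred-view o
  ... | inj₁ p       = contradiction (trans p o≡0) λ ()
  ... | inj₂ (_ , p) = p

  ≤top : ∀ {i : Fin n} → toℕ i ≤ toℕ top
  ≤top {i} = ℕₚ.≤-pred (subst (toℕ i <_) (sym top≡) (toℕ<n i))

  -- Each cell is traversed from a hub and back.
  mid-from : ∀ k → toℕ a ≤ toℕ k → toℕ k < toℕ b → chord bwd ↝ side k fwd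
  mid-from k p q = via {chord bwd} refl ◅◅
    climb (λ i → side i fwd) a k p λ l r s → via (depart-side
      (>⇒≢ (subst (toℕ a <_) (sym (succ-< {j = k} s)) (s≤s r)))
      (<⇒≢ (subst (_< toℕ b) (sym (succ-< {j = k} s)) (ℕₚ.≤-<-trans s q))))

  mid-to : ∀ k → toℕ a ≤ toℕ k → toℕ k < toℕ b → side k fwd ↝ chord bwd
  mid-to k p q = via {side k fwd} refl ◅◅
    subst (depart (succ k) ↝_) depart-b
      (depart-climb (succ k) b (subst (_≤ toℕ b) (sym sk) q)
        λ l r s → >⇒≢ (ℕₚ.≤-<-trans p (subst (_≤ toℕ l) sk r)) , <⇒≢ s)
    where sk = succ-< {j = b} q

  low-to : ∀ k → toℕ k ≤ toℕ a → depart k ↝ chord fwd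
  low-to k p = subst (depart k ↝_) depart-a
    (depart-climb k a p λ l _ s → <⇒≢ s , <⇒≢ (ℕₚ.<-trans s a<b))

  high-climb : ∀ i j → toℕ b ≤ toℕ i → toℕ i ≤ toℕ j → side i fwd ↝ side j fwd
  high-climb i j p q = climb (λ i → side i fwd) i j q λ l r s →
    let b<sl = subst (toℕ b <_) (sym (succ-< {j = j} s)) (s≤s (ℕₚ.≤-trans p r))
    in via (depart-side (>⇒≢ (ℕₚ.<-trans a<b b<sl)) (>⇒≢ b<sl))

  high-from : ∀ k → toℕ b ≤ toℕ k → chord fwd ↝ side k fwd
  high-from k p = via {chord fwd} refl ◅◅ high-climb b k ℕₚ.≤-refl p

  top-o : side top fwd ↝ depart o
  top-o = via (cong depart (succ-pred o))

  high-to : ∀ k → toℕ b ≤ toℕ k → side k fwd ↝ chord fwd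
  high-to k p = high-climb k top p ≤top ◅◅ top-o ◅◅ low-to o o≤

  low-from : ∀ k → toℕ k < toℕ a → chord fwd ↝ side k fwd
  low-from k p = high-from top ≤top ◅◅ top-o ◅◅
    subst (depart o ↝_) (depart-side (<⇒≢ p) (<⇒≢ (ℕₚ.<-trans p a<b)))
      (depart-climb o k o≤ λ l _ s →
        <⇒≢ (ℕₚ.<-trans s p) , <⇒≢ (ℕₚ.<-trans s (ℕₚ.<-trans p a<b)))

  low-to′ : ∀ k → toℕ k < toℕ a → side k fwd ↝ chord fwd
  low-to′ k p = via {side k fwd} refl ◅◅
    low-to (succ k) (subst (_≤ toℕ a) (sym (succ-< {j = a} p)) p)

  pred-succ : ∀ (i : Fin n) → pred (succ i) ≡ i
  pred-succ i = succ-injective (succ-pred (succ i))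

  back : ∀ i j → toℕ i ≤ toℕ j → side j bwd ↝ side i bwd
  back i j p = unflip (climb {R = λ x y → next y ≡ x} (λ i → side i bwd) i j p
    λ k _ _ → cong (λ x → side x bwd) (pred-succ k) ◅ ε)
    where
    unflip : ∀ {x y} → Star (λ x y → next y ≡ x) x y → y ↝ x
    unflip ε        = ε
    unflip (p ◅ ps) = unflip ps ◅◅ via p

  hub : Fin 3 → Dart
  hub zero             = side o bwd
  hub (suc zero)       = chord bwd
  hub (suc (suc zero)) = chord fwd

  to-hub : ∀ d → d ↝ hub (cell d)
  to-hub (chord fwd)  = ε
  to-hub (chord bwd)  = ε
  to-hub (side i bwd) = back o i o≤
  to-hub (side i fwd) with arc i
  ... | low p   rewrite below p    = low-to′ i p
  ... | mid p q rewrite inside p q = mid-to i p q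
  ... | high p  rewrite above p    = high-to i p

  from-hub : ∀ d → hub (cell d) ↝ d
  from-hub (chord fwd)  = ε
  from-hub (chord bwd)  = ε
  from-hub (side i bwd) = via {side o bwd} refl ◅◅ back i top ≤top
  from-hub (side i fwd) with arc i
  ... | low p   rewrite below p    = low-from i p
  ... | mid p q rewrite inside p q = mid-from i p q
  ... | high p  rewrite above p    = high-from i p

  cell-orbit : ∀ d d′ → cell d ≡ cell d′ → d ↝ d′
  cell-orbit d d′ eq =
    to-hub d ◅◅ subst (λ c → hub c ↝ d′) (sym eq) (from-hub d′)

  -- Around v the darts are: side v fwd, side (pred v) bwd, and the chord if
  -- v is one of its ends.
  infix 4 _⟳_
  _⟳_ : Dart → Dart → Set
  _⟳_ = Orbit (next ∘ rev)

  in-out : ∀ v → side v fwd ⟳ side (pred v) bwd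
  in-out v = refl ◅ ε

  out-depart : ∀ i → side i bwd ⟳ depart (succ i)
  out-depart i = refl ◅ ε

  pred-depart : ∀ v → side (pred v) bwd ⟳ depart v
  pred-depart v = cong depart (succ-pred v) ◅ ε

  depart-in : ∀ v → depart v ⟳ side v fwd
  depart-in v with place v
  ... | at-a refl rewrite depart-a = refl ◅ ε
  ... | at-b refl rewrite depart-b = refl ◅ ε
  ... | off p q   rewrite depart-side p q = ε

  rot-to : ∀ d → d ⟳ side (src d) fwd
  rot-to (chord fwd)  = refl ◅ ε
  rot-to (chord bwd)  = refl ◅ ε
  rot-to (side i fwd) = ε
  rot-to (side i bwd) = out-depart i ◅◅ depart-in (succ i)

  rot-from : ∀ d → side (src d) fwd ⟳ d
  rot-from (chord fwd)  = in-out a ◅◅ subst (_ ⟳_) depart-a (pred-depart a)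
  rot-from (chord bwd)  = in-out b ◅◅ subst (_ ⟳_) depart-b (pred-depart b)
  rot-from (side i fwd) = ε
  rot-from (side i bwd) =
    subst (λ x → side (succ i) fwd ⟳ side x bwd) (pred-succ i) (in-out (succ i))

  rotation : ∀ d d′ → src d ≡ src d′ → d ⟳ d′
  rotation d d′ eq =
    rot-to d ◅◅ subst (λ v → side v fwd ⟳ d′) (sym eq) (rot-from d′)

  next-src : ∀ d → src (next d) ≡ src (rev d)
  next-src (chord fwd)  = refl
  next-src (chord bwd)  = refl
  next-src (side i fwd) = src-depart (succ i)
  next-src (side i bwd) = succ-pred i

  n≥3 : 3 ≤ n
  n≥3 = ℕₚ.≤-trans (s≤s (ℕₚ.≤-trans (s≤s (s≤s z≤n)) a+2≤b)) (toℕ<n b)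
    where
    a+2≤b : 2 + toℕ a ≤ toℕ b
    a+2≤b = ℕₚ.≤∧≢⇒< a<b λ eq →
      nonadjacent (inj₁ (toℕ-injective (trans (sym eq) (sym (succ-< {j = b} a<b)))))

  succ≢ : ∀ i → i ≢ succ i
  succ≢ i eq with succ-view i
  ... | inj₁ p       = ℕₚ.1+n≢n (sym (trans (cong toℕ eq) p))
  ... | inj₂ (p , q) = ℕₚ.<-irrefl
    (trans (cong suc (sym (trans (cong toℕ eq) q))) p) (ℕₚ.≤-trans (s≤s (s≤s z≤n)) n≥3)

  succ²≢ : ∀ i → i ≢ succ (succ i)
  succ²≢ i eq with succ-view i | succ-view (succ i)
  ... | inj₁ p       | inj₁ q       = ℕₚ.<-irrefl
    (trans (cong toℕ eq) (trans q (cong suc p))) (s≤s (ℕₚ.n≤1+n _))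
  ... | inj₁ p       | inj₂ (q , r) = ℕₚ.<-irrefl
    (trans (cong (2 +_) (sym (trans (cong toℕ eq) r))) (trans (cong suc (sym p)) q)) n≥3
  ... | inj₂ (p , q) | inj₁ r       = ℕₚ.<-irrefl
    (trans (cong suc (sym (trans (cong toℕ eq) (trans r (cong suc q))))) p) n≥3
  ... | inj₂ (_ , q) | inj₂ (r , _) = ℕₚ.<-irrefl
    (trans (cong suc (sym q)) r) (ℕₚ.≤-trans (s≤s (s≤s z≤n)) n≥3)

  loopless : ∀ d → src d ≢ src (rev d)
  loopless (chord fwd)  = a≢b
  loopless (chord bwd)  = a≢b ∘ sym
  loopless (side i fwd) = succ≢ i
  loopless (side i bwd) = succ≢ i ∘ sym

  simple : ∀ d d′ → src d ≡ src d′ → src (rev d) ≡ src (rev d′) → d ≡ d′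
  simple (chord fwd)  (chord fwd)  p q = refl
  simple (chord fwd)  (chord bwd)  p q = contradiction p a≢b
  simple (chord fwd)  (side j fwd) refl q = contradiction (inj₁ q) nonadjacent
  simple (chord fwd)  (side j bwd) p refl = contradiction (inj₂ p) nonadjacent
  simple (chord bwd)  (chord fwd)  p q = contradiction q a≢b
  simple (chord bwd)  (chord bwd)  p q = refl
  simple (chord bwd)  (side j fwd) refl q = contradiction (inj₂ q) nonadjacent
  simple (chord bwd)  (side j bwd) p refl = contradiction (inj₁ p) nonadjacent
  simple (side i fwd) (chord fwd)  refl q = contradiction (inj₁ (sym q)) nonadjacent
  simple (side i fwd) (chord bwd)  refl q = contradiction (inj₂ (sym q)) nonadjacent
  simple (side i fwd) (side j fwd) refl q = refl
  simple (side i fwd) (side j bwd) p refl = contradiction (sym p) (succ²≢ i ∘ sym)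
  simple (side i bwd) (chord fwd)  p refl = contradiction (inj₂ (sym p)) nonadjacent
  simple (side i bwd) (chord bwd)  p refl = contradiction (inj₁ (sym p)) nonadjacent
  simple (side i bwd) (side j fwd) p refl = contradiction p (succ²≢ j ∘ sym)
  simple (side i bwd) (side j bwd) p refl = refl

  Edge : Fin n → Fin n → Set
  Edge x y = ∃[ d ] (src d ≡ x × src (rev d) ≡ y)

  connected : ∀ u v → Star Edge u v
  connected u v = reverse (λ (d , p , q) → rev d , q , trans (cong src (rev² d)) p)
                          (fromBottom u) ◅◅ fromBottom v
    where
    rev² : ∀ d → rev (rev d) ≡ d
    rev² (_ , fwd) = refl
    rev² (_ , bwd) = refl
    fromBottom : ∀ w → Star Edge o w
    fromBottom w = climb (λ x → x) o w o≤ λ k _ _ → (side k fwd , refl , refl) ◅ ε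

  board : Board
  board = record
    { #V = n ; #E = suc n ; #C = 2
    ; src = src ; loopless = loopless ; simple = simple ; connected = connected
    ; next = next ; next-src = next-src ; rotation = rotation
    ; cell = cell ; cell-next = cell-next ; cell-orbit = cell-orbit
    ; cell-onto = cell-onto
    ; euler = ℕₚ.+-suc n 2
    }

chordBoard : ∀ n (a b : Fin n) → a Fin.< b → ¬ CycleAdjacent a b → Board
chordBoard = ChordBoard.board

{-# OPTIONS --safe #-}
module Submission where

{-
Call the player who is claimed to win the hero.  The hero sees to it that the
chord is marked early, with an even number of sides unmarked when the opponent
is to move.

Two arrows on consecutive sides then agree, except that at each end of the chord
one pair of opposite arrows is allowed.  If both exceptional pairs have become
impossible ("both ends are dead"), then in a final position the arrows around the
cycle change direction exactly at the unmarked sides, so that their number is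
even and the hero moves last.  Completing cells does not disturb this: nobody
wants to leave a cell one arrow short, and by the same parity argument, applied
with such a cell filled in, the hero is never forced to.

An end is killed by one suitable arrow on either of its two sides, which never
helps to complete a cell.  One move of the opponent can prevent at most one of
these two, so the hero kills the ends one after the other, unless an arrow of the
opponent threatens both ends at once.  That happens only in the middle of an arc
of three sides.  There the two other sides of the arc have become taboo for both
players, and the hero makes the position symmetric under the reflection that
exchanges the ends of the chord, and from then on mirrors the opponent's moves.
-}

open import Defs
open import Algebra.Bundles using (module CommutativeRing)
import Algebra.Properties.CommutativeMonoid.Sum as Sum
open import Data.Bool.Base using (Bool; true; false; not; _xor_; if_then_else_)
open import Data.Bool.Properties as Boolₚ using (xor-∧-commutativeRing)
open import Data.Empty using (⊥; ⊥-elim)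
open import Data.Fin.Base using (Fin; zero; suc; toℕ; _<_)
open import Data.Fin.Permutation using (Permutation; permutation)
open import Data.Fin.Properties as Finₚ using (any?; all?)
open import Data.List.Base using (List; []; _∷_)
open import Data.List.Membership.Propositional using (_∈_; _∉_)
import Data.List.Membership.DecPropositional as DecMembership
open import Data.List.Relation.Unary.Any using (here; there)
open import Data.Maybe.Base using (Maybe; just; nothing; _>>=_)
open import Data.Nat.Base as ℕ using (ℕ; zero; suc; _+_; _*_; _∸_; _≤_)
open import Data.Nat.Divisibility using (_∣_; divides; ∣⇒≤; ∣-refl; _∣0; ∣m∣n⇒∣m+n)
open import Data.Nat.DivMod using
  (_/_; _%_; m%n<n; m%n%n≡m%n; m<n⇒m%n≡m; m≡m%n+[m/n]*n; [m+n]%n≡m%n; [m+kn]%n≡m%n; %-distribˡ-+)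
open import Data.Nat.Primality using (euclidsLemma; prime[2])
import Data.Nat.Properties as ℕₚ
open import Data.Product.Base using (_×_; _,_; ∃-syntax; proj₁; proj₂)
open import Data.Product.Properties using (≡-dec)
open import Data.Sum.Base using (_⊎_; inj₁; inj₂)
open import Function.Base using (_∘_; case_of_)
open import Function.Bundles using (mk⇔)
open import Relation.Binary.Definitions using (DecidableEquality)
open import Relation.Binary.PropositionalEquality
open import Relation.Nullary using (¬_; Dec; yes; no; does; contradiction)
open import Relation.Nullary.Decidable
  using (map′; does-⇔; dec-true; dec-false; _×-dec_; _⊎-dec_; _→-dec_; ¬?)

open Sum (CommutativeRing.+-commutativeMonoid xor-∧-commutativeRing)
  using (sum; sum-permute; ∑-distrib-+)

-- Directions and players.

infix 4 _≟ᵈ_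
_≟ᵈ_ : DecidableEquality Direction
fwd ≟ᵈ fwd = yes refl
fwd ≟ᵈ bwd = no λ ()
bwd ≟ᵈ fwd = no λ ()
bwd ≟ᵈ bwd = yes refl

flip-involutive : ∀ s → flip (flip s) ≡ s
flip-involutive fwd = refl
flip-involutive bwd = refl

flip-≢ : ∀ s → flip s ≢ s
flip-≢ fwd ()
flip-≢ bwd ()

≢⇒flip : ∀ {s t} → s ≢ t → s ≡ flip t
≢⇒flip {fwd} {fwd} p = contradiction refl p
≢⇒flip {fwd} {bwd} p = refl
≢⇒flip {bwd} {fwd} p = refl
≢⇒flip {bwd} {bwd} p = contradiction refl p

all-directions? : ∀ {P : Direction → Set} → (∀ s → Dec (P s)) → Dec (∀ s → P s)
all-directions? P? = map′ (λ { (p , q) fwd → p ; (p , q) bwd → q })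
                          (λ f → f fwd , f bwd) (P? fwd ×-dec P? bwd)

any-direction? : ∀ {P : Direction → Set} → (∀ s → Dec (P s)) → Dec (∃[ s ] P s)
any-direction? P? = map′ (λ { (inj₁ p) → fwd , p ; (inj₂ q) → bwd , q })
                         (λ { (fwd , p) → inj₁ p ; (bwd , q) → inj₂ q })
                         (P? fwd ⊎-dec P? bwd)

opponent-involutive : ∀ p → opponent (opponent p) ≡ p
opponent-involutive player₁ = refl
opponent-involutive player₂ = refl

opponent-≢ : ∀ {p} → p ≢ opponent p
opponent-≢ {player₁} ()
opponent-≢ {player₂} ()

-- Winning trees and the strategies they yield.

module Play (B : Board) where
  open Board B
  open Game B

  rev-involutive : ∀ d → rev (rev d) ≡ d
  rev-involutive (e , s) = cong (e ,_) (flip-involutive s)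

  infix 4 _≟ᴰ_
  _≟ᴰ_ : DecidableEquality Dart
  _≟ᴰ_ = ≡-dec Finₚ._≟_ _≟ᵈ_

  open DecMembership _≟ᴰ_ using (_∈?_) public

  all-darts? : ∀ {P : Dart → Set} → (∀ d → Dec (P d)) → Dec (∀ d → P d)
  all-darts? P? = map′ (λ f (e , s) → f e s) (λ f e s → f (e , s))
                       (all? λ e → all-directions? λ s → P? (e , s))

  Legal? : ∀ h d → Dec (Legal h d)
  Legal? h d = map′ (λ (u , p , q) → legal u p q) (λ (legal u p q) → u , p , q)
    ((¬? (d ∈? h) ×-dec ¬? (rev d ∈? h)) ×-dec
     all? (λ v → ¬? (all-darts? λ e → tgt e Finₚ.≟ v →-dec e ∈? d ∷ h)) ×-dec
     all? (λ v → ¬? (all-darts? λ e → src e Finₚ.≟ v →-dec e ∈? d ∷ h)))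

  Cyclic : History → Set
  Cyclic h = ∃[ c ] CycleCell h c

  Finished? : ∀ h → Dec (Finished h)
  Finished? h =
    any? (λ c → all-darts? (λ d → cell d Finₚ.≟ suc c →-dec d ∈? h) ⊎-dec
                all-darts? (λ d → cell d Finₚ.≟ suc c →-dec rev d ∈? h)) ⊎-dec
    all-darts? (λ d → ¬? (Legal? h d))

  -- `await` demands nothing in a finished position, because `p` moved last there and has won; only
  -- the empty history is different, hence `unfinished` below. In `reply`, the legal move and the
  -- absence of a cycle cell show that play has not ended on the turn of `p`.
  data Win (p : Player) (h : History) : Set where
    reply : toMove h ≡ p → ¬ Cyclic h → ∀ d → Legal h d → Win p (d ∷ h) → Win p h
    await : toMove h ≡ opponent p →
            (∀ d → ¬ Finished h → Legal h d → Win p (d ∷ h)) → Win p h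

  module _ {p : Player} (win : Win p []) (unfinished : ¬ Finished []) where

    follow : ∀ {h} → Win p h → ∀ d → Maybe (Win p (d ∷ h))
    follow (reply _ _ e _ w) d with d ≟ᴰ e
    ... | yes refl = just w
    ... | no _     = nothing
    follow {h} (await _ f) d with Finished? h | Legal? h d
    ... | no nf | yes l = just (f d nf l)
    ... | _     | _     = nothing

    -- A strategy sees only the history, so the current place in the tree is recovered by replaying
    -- the moves from the root.
    track : ∀ h → Maybe (Win p h)
    track []      = just win
    track (d ∷ h) = track h >>= λ w → follow w d

    choice : ∀ {h} → Maybe (Win p h) → Dart
    choice (just (reply _ _ d _ _)) = d
    -- A strategy is total; off the tree any dart will do, and `cell-onto` provides one.
    choice _                        = proj₁ (cell-onto zero)

    strategy : Strategy
    strategy h = choice (track h)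

    on-track : ∀ {h} → Arises p strategy h → ∃[ w ] track h ≡ just w
    on-track start = win , refl
    on-track (own {h} ar nf mine _) with track h | on-track ar
    ... | .(just (reply _ _ d _ w)) | reply _ _ d _ w , refl with d ≟ᴰ d
    ...   | yes refl = w , refl
    ...   | no d≢d   = contradiction refl d≢d
    on-track (own {h} ar nf mine _) | .(just (await _ _)) | await theirs _ , refl =
      contradiction (trans (sym mine) theirs) opponent-≢
    on-track (opposing {h} {d} ar nf theirs l) with track h | on-track ar
    ... | .(just (reply _ _ _ _ _)) | reply mine _ _ _ _ , refl =
      contradiction (trans (sym mine) theirs) opponent-≢
    ... | .(just (await _ f)) | await _ f , refl with Finished? h | Legal? h d
    ...   | no nf′ | yes l′ = f d nf′ l′ , refl
    ...   | yes fin | _     = contradiction fin nf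
    ...   | no _ | no ¬l    = contradiction l ¬l

    canMove : ∀ {h} → Arises p strategy h → ¬ Finished h → toMove h ≡ p →
              Legal h (strategy h)
    canMove {h} ar nf mine with track h | on-track ar
    ... | .(just (reply _ _ _ l _)) | reply _ _ _ l _ , refl = l
    ... | .(just (await _ _)) | await theirs _ , refl =
      contradiction (trans (sym mine) theirs) opponent-≢

    wins : ∀ {h} → Arises p strategy h → Finished h → lastMover h ≡ just p
    wins {h} ar fin with proj₁ (on-track ar)
    wins {h} ar (inj₁ cyc) | reply _ ¬cyc _ _ _ = contradiction cyc ¬cyc
    wins {h} ar (inj₂ stuck) | reply _ _ d l _  = contradiction l (stuck d)
    wins {[]} ar fin | await _ _ = contradiction fin unfinished
    wins {d ∷ h} ar fin | await theirs _ = cong just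
      (trans (sym (opponent-involutive _))
             (trans (cong opponent theirs) (opponent-involutive p)))

    winning : HasWinningStrategy B p
    winning = strategy , record { canMove = canMove ; wins = wins }

-- Rotations and reflections of the cycle

rotate : ∀ {n} → ℕ → Fin n → Fin n
rotate zero    i = i
rotate (suc k) i = succ (rotate k i)

rotate-+ : ∀ {n} k l (i : Fin n) → rotate (k + l) i ≡ rotate k (rotate l i)
rotate-+ zero    l i = refl
rotate-+ (suc k) l i = cong succ (rotate-+ k l i)

suc-% : ∀ x m → suc (x % suc m) % suc m ≡ suc x % suc m
suc-% x m = begin
  suc (x % suc m) % suc m                     ≡⟨ %-distribˡ-+ 1 (x % suc m) (suc m) ⟩
  (1 % suc m + x % suc m % suc m) % suc m     ≡⟨ cong (λ y → (1 % suc m + y) % suc m)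
                                                   (m%n%n≡m%n x (suc m)) ⟩
  (1 % suc m + x % suc m) % suc m             ≡⟨ %-distribˡ-+ 1 x (suc m) ⟨
  suc x % suc m                               ∎
  where open ≡-Reasoning

toℕ-rotate : ∀ {m} k (i : Fin (suc m)) → toℕ (rotate k i) ≡ (toℕ i + k) % suc m
toℕ-rotate {m} zero    i = sym (trans (cong (_% suc m) (ℕₚ.+-identityʳ (toℕ i)))
                                      (m<n⇒m%n≡m (Finₚ.toℕ<n i)))
toℕ-rotate {m} (suc k) i = begin
  toℕ (succ (rotate k i))           ≡⟨ toℕ-mod (suc (toℕ (rotate k i))) m ⟩
  suc (toℕ (rotate k i)) % suc m    ≡⟨ cong (λ x → suc x % suc m) (toℕ-rotate k i) ⟩
  suc ((toℕ i + k) % suc m) % suc m ≡⟨ suc-% (toℕ i + k) m ⟩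
  suc (toℕ i + k) % suc m           ≡⟨ cong (_% suc m) (ℕₚ.+-suc (toℕ i) k) ⟨
  (toℕ i + suc k) % suc m           ∎
  where open ≡-Reasoning

rotate-fixed⇒∣ : ∀ {n} k (i : Fin n) → rotate k i ≡ i → n ∣ k
rotate-fixed⇒∣ {suc m} k i eq = divides ((toℕ i + k) / suc m)
  (ℕₚ.+-cancelˡ-≡ (toℕ i) _ _ (trans (m≡m%n+[m/n]*n (toℕ i + k) (suc m))
    (cong (_+ (toℕ i + k) / suc m * suc m) (trans (sym (toℕ-rotate k i)) (cong toℕ eq)))))

∣⇒rotate-fixed : ∀ {n k} (i : Fin n) → n ∣ k → rotate k i ≡ i
∣⇒rotate-fixed {suc m} i (divides q refl) = Finₚ.toℕ-injective
  (trans (toℕ-rotate (q * suc m) i)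
    (trans ([m+kn]%n≡m%n (toℕ i) q (suc m)) (m<n⇒m%n≡m (Finₚ.toℕ<n i))))

rotate-≢ : ∀ {n} k → .{{ℕ.NonZero k}} → k ℕ.< n → (i : Fin n) → rotate k i ≢ i
rotate-≢ k k<n i eq = ℕₚ.<⇒≱ k<n (∣⇒≤ (rotate-fixed⇒∣ k i eq))

rotate-half-≢ : ∀ {n} k → n ≡ k * 2 → (i : Fin n) → rotate k i ≢ i
rotate-half-≢ (suc k) refl = rotate-≢ (suc k) (ℕₚ.m<m*n (suc k) 2 (ℕ.s≤s (ℕ.s≤s ℕ.z≤n)))

rotate-onto : ∀ {n} (i j : Fin n) → ∃[ k ] rotate k i ≡ j
rotate-onto {suc m} i j = toℕ j + (suc m ∸ toℕ i) , Finₚ.toℕ-injective (begin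
  toℕ (rotate (toℕ j + (suc m ∸ toℕ i)) i)      ≡⟨ toℕ-rotate _ i ⟩
  (toℕ i + (toℕ j + (suc m ∸ toℕ i))) % suc m   ≡⟨ cong (_% suc m) wrap ⟩
  (toℕ j + suc m) % suc m                       ≡⟨ [m+n]%n≡m%n (toℕ j) (suc m) ⟩
  toℕ j % suc m                                 ≡⟨ m<n⇒m%n≡m (Finₚ.toℕ<n j) ⟩
  toℕ j                                         ∎)
  where
  open ≡-Reasoning
  wrap : toℕ i + (toℕ j + (suc m ∸ toℕ i)) ≡ toℕ j + suc m
  wrap = begin
    toℕ i + (toℕ j + (suc m ∸ toℕ i))   ≡⟨ ℕₚ.+-assoc (toℕ i) (toℕ j) _ ⟨
    toℕ i + toℕ j + (suc m ∸ toℕ i)     ≡⟨ cong (_+ (suc m ∸ toℕ i)) (ℕₚ.+-comm (toℕ i) (toℕ j)) ⟩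
    toℕ j + toℕ i + (suc m ∸ toℕ i)     ≡⟨ ℕₚ.+-assoc (toℕ j) (toℕ i) _ ⟩
    toℕ j + (toℕ i + (suc m ∸ toℕ i))   ≡⟨ cong (toℕ j +_)
                                             (ℕₚ.m+[n∸m]≡n (ℕₚ.<⇒≤ (Finₚ.toℕ<n i))) ⟩
    toℕ j + suc m                       ∎

succ-induction : ∀ {n} {P : Fin n → Set} (i : Fin n) →
  P i → (∀ j → P j → P (succ j)) → ∀ j → P j
succ-induction {P = P} i base step j with rotate-onto i j
... | k , refl = go k
  where
  go : ∀ k → P (rotate k i)
  go zero    = base
  go (suc k) = step _ (go k)

pred-succ : ∀ {n} (i : Fin n) → pred (succ i) ≡ i
pred-succ i = succ-injective (succ-pred (succ i))

succ-permutation : ∀ {n} → Permutation n n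
succ-permutation = permutation succ pred succ-pred pred-succ

-- The reflection of the cycle that exchanges the vertices a and b sends the
-- vertex v to a + b - v, hence the side from i to i + 1 to the side starting
-- at a + b - 1 - i.
ρ : ∀ {n} → Fin n → Fin n → Fin n → Fin n
ρ {suc m} a b i = rotate (toℕ b + (m ∸ toℕ i)) a

ρ-succ : ∀ {n} (a b i : Fin n) → ρ a b (succ i) ≡ pred (ρ a b i)
ρ-succ {suc m} a b i = succ-injective (trans (shift (succ-view i)) (sym (succ-pred _)))
  where
  β = toℕ b
  shift : toℕ (succ i) ≡ suc (toℕ i) ⊎ (suc (toℕ i) ≡ suc m × toℕ (succ i) ≡ 0) →
          succ (ρ a b (succ i)) ≡ ρ a b i
  shift (inj₁ p) = cong (λ k → rotate k a) (begin
    suc (β + (m ∸ toℕ (succ i)))   ≡⟨ ℕₚ.+-suc β _ ⟨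
    β + suc (m ∸ toℕ (succ i))     ≡⟨ cong (λ x → β + suc (m ∸ x)) p ⟩
    β + suc (m ∸ suc (toℕ i))      ≡⟨ cong (β +_) (ℕₚ.+-∸-assoc 1 i<m) ⟨
    β + (m ∸ toℕ i)                ∎)
    where
    open ≡-Reasoning
    i<m : toℕ i ℕ.< m
    i<m = ℕₚ.≤-pred (subst (ℕ._< suc m) p (Finₚ.toℕ<n (succ i)))
  -- Wrap-around: `i` is the last side and `succ i` the first, and the two exponents differ by a
  -- full turn.
  shift (inj₂ (p , q)) = begin
    rotate (suc (β + (m ∸ toℕ (succ i)))) a ≡⟨ cong (λ x → rotate (suc (β + (m ∸ x))) a) q ⟩
    rotate (suc (β + m)) a                  ≡⟨ cong (λ k → rotate k a) (ℕₚ.+-suc β m) ⟨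
    rotate (β + suc m) a                    ≡⟨ rotate-+ β (suc m) a ⟩
    rotate β (rotate (suc m) a)             ≡⟨ cong (rotate β) (∣⇒rotate-fixed a ∣-refl) ⟩
    rotate β a                              ≡⟨ cong (λ k → rotate k a) (ℕₚ.+-identityʳ β) ⟨
    rotate (β + 0) a                        ≡⟨ cong (λ k → rotate (β + k) a) (ℕₚ.n∸n≡0 m) ⟨
    rotate (β + (m ∸ m)) a                  ≡⟨ cong (λ x → rotate (β + (m ∸ x)) a) (ℕₚ.suc-injective p) ⟨
    rotate (β + (m ∸ toℕ i)) a              ∎
    where open ≡-Reasoning

ρ-pred : ∀ {n} (a b i : Fin n) → ρ a b (pred i) ≡ succ (ρ a b i)
ρ-pred a b i = trans (sym (succ-pred _))
  (cong succ (trans (sym (ρ-succ a b (pred i))) (cong (ρ a b) (succ-pred i))))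

ρ-start : ∀ {n} (a b : Fin n) → ρ a b a ≡ pred b
ρ-start {suc m} a b = Finₚ.toℕ-injective (begin
  toℕ (rotate (β + (m ∸ α)) a)      ≡⟨ toℕ-rotate (β + (m ∸ α)) a ⟩
  (α + (β + (m ∸ α))) % suc m       ≡⟨ cong (_% suc m) (ℕₚ.+-comm α _) ⟩
  (β + (m ∸ α) + α) % suc m         ≡⟨ cong (_% suc m) (ℕₚ.+-assoc β (m ∸ α) α) ⟩
  (β + (m ∸ α + α)) % suc m         ≡⟨ cong (λ x → (β + x) % suc m)
                                         (ℕₚ.m∸n+n≡m (ℕₚ.≤-pred (Finₚ.toℕ<n a))) ⟩
  (β + m) % suc m                   ≡⟨ toℕ-mod (β + m) m ⟨
  toℕ (pred b)                      ∎)
  where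
  open ≡-Reasoning
  α = toℕ a
  β = toℕ b

ρ-end : ∀ {n} (a b : Fin n) → ρ a b b ≡ pred a
ρ-end {suc m} a b = Finₚ.toℕ-injective (begin
  toℕ (rotate (β + (m ∸ β)) a) ≡⟨ cong (λ k → toℕ (rotate k a))
                                    (ℕₚ.m+[n∸m]≡n (ℕₚ.≤-pred (Finₚ.toℕ<n b))) ⟩
  toℕ (rotate m a)             ≡⟨ toℕ-rotate m a ⟩
  (toℕ a + m) % suc m          ≡⟨ toℕ-mod (toℕ a + m) m ⟨
  toℕ (pred a)                 ∎)
  where
  open ≡-Reasoning
  β = toℕ b

-- `ρ` turns `succ` into `pred`, so its square commutes with `succ` and needs checking at `a` only.
ρ-involutive : ∀ {n} (a b i : Fin n) → ρ a b (ρ a b i) ≡ i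
ρ-involutive a b = succ-induction a
  (trans (cong (ρ a b) (ρ-start a b))
    (trans (ρ-pred a b b) (trans (cong succ (ρ-end a b)) (succ-pred a))))
  λ i eq → trans (cong (ρ a b) (ρ-succ a b i)) (trans (ρ-pred a b _) (cong succ eq))

-- A reflection conjugates each rotation to its inverse, so the two rotations cancel.
ρ-rotate : ∀ {n} (a b : Fin n) k {i} → ρ a b i ≡ i → rotate k (ρ a b (rotate k i)) ≡ i
ρ-rotate a b zero    fix = fix
ρ-rotate a b (suc k) {i} fix = begin
  succ (rotate k (ρ a b (succ (rotate k i))))  ≡⟨ cong (succ ∘ rotate k) (ρ-succ a b (rotate k i)) ⟩
  rotate (1 + k) (pred (ρ a b (rotate k i)))   ≡⟨ cong (λ l → rotate l (pred (ρ a b (rotate k i))))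
                                                       (ℕₚ.+-comm 1 k) ⟩
  rotate (k + 1) (pred (ρ a b (rotate k i)))   ≡⟨ rotate-+ k 1 _ ⟩
  rotate k (succ (pred (ρ a b (rotate k i))))  ≡⟨ cong (rotate k) (succ-pred _) ⟩
  rotate k (ρ a b (rotate k i))                ≡⟨ ρ-rotate a b k fix ⟩
  i                                            ∎
  where open ≡-Reasoning

rotate-injective : ∀ {n} k {i j : Fin n} → rotate k i ≡ rotate k j → i ≡ j
rotate-injective zero    eq = eq
rotate-injective (suc k) eq = rotate-injective k (succ-injective eq)

ρ-fixed⇒∣ : ∀ {n} (a b : Fin n) k {i} → ρ a b i ≡ i →
  ρ a b (rotate k i) ≡ rotate k i → n ∣ k + k
ρ-fixed⇒∣ a b k {i} fix fix′ = rotate-fixed⇒∣ (k + k) i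
  (trans (rotate-+ k k i) (trans (cong (rotate k) (sym fix′)) (ρ-rotate a b k fix)))

-- If two fixed sides are `k` apart, then `n` divides `k + k`; being odd, it divides `k`.
ρ-fixed-odd : ∀ {n} (a b : Fin n) → ¬ 2 ∣ n →
  ∀ {i j} → ρ a b i ≡ i → ρ a b j ≡ j → i ≡ j
ρ-fixed-odd {n} a b n-odd {i} {j} fi fj with rotate-onto i j
... | k , refl with ρ-fixed⇒∣ a b k fi fj
...   | divides q eq with euclidsLemma q n prime[2] (divides k (trans (sym eq) double))
  where
  double : k + k ≡ k * 2
  double = trans (cong (k +_) (sym (ℕₚ.+-identityʳ k))) (ℕₚ.*-comm 2 k)
...     | inj₂ 2∣n = contradiction 2∣n n-odd
...     | inj₁ (divides r refl) = sym (∣⇒rotate-fixed i (divides r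
            (ℕₚ.*-cancelʳ-≡ k (r * n) 2 (begin
              k * 2     ≡⟨ ℕₚ.*-comm k 2 ⟩
              2 * k     ≡⟨ cong (k +_) (ℕₚ.+-identityʳ k) ⟩
              k + k     ≡⟨ eq ⟩
              r * 2 * n ≡⟨ ℕₚ.*-assoc r 2 n ⟩
              r * (2 * n) ≡⟨ cong (r *_) (ℕₚ.*-comm 2 n) ⟩
              r * (n * 2) ≡⟨ ℕₚ.*-assoc r n 2 ⟨
              r * n * 2 ∎))))
  where open ≡-Reasoning

-- The half turn is its own inverse, so it commutes with the reflection.
antipode-fixed : ∀ {n} (a b : Fin n) m → n ≡ m * 2 →
  ∀ {i} → ρ a b i ≡ i → ρ a b (rotate m i) ≡ rotate m i
antipode-fixed {n} a b m eq {i} fix = rotate-injective m (begin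
  rotate m (ρ a b (rotate m i)) ≡⟨ ρ-rotate a b m fix ⟩
  i                             ≡⟨ ∣⇒rotate-fixed i (divides 1 m+m) ⟨
  rotate (m + m) i              ≡⟨ rotate-+ m m i ⟩
  rotate m (rotate m i)         ∎)
  where
  open ≡-Reasoning
  m+m : m + m ≡ 1 * n
  m+m = begin
    m + m         ≡⟨ cong (m +_) (ℕₚ.+-identityʳ m) ⟨
    2 * m         ≡⟨ ℕₚ.*-comm 2 m ⟩
    m * 2         ≡⟨ eq ⟨
    n             ≡⟨ ℕₚ.*-identityˡ n ⟨
    1 * n         ∎

-- If the fixed sides are `k` apart, `k + k` is a multiple of `n`, so `k` is a multiple `q * m` of
-- `m`. The parity of `q` separates the two cases.
ρ-fixed-even : ∀ {n} (a b : Fin n) m → n ≡ m * 2 →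
  ∀ {i j} → ρ a b i ≡ i → ρ a b j ≡ j → j ≡ i ⊎ j ≡ rotate m i
ρ-fixed-even {n} a b m refl {i} {j} fi fj with rotate-onto i j
... | k , refl with ρ-fixed⇒∣ a b k fi fj
...   | divides q eq = go (q % 2) (q / 2) (m%n<n q 2) (m≡m%n+[m/n]*n q 2)
  where
  open ≡-Reasoning
  k≡ : k ≡ q * m
  k≡ = ℕₚ.*-cancelʳ-≡ k (q * m) 2 (begin
    k * 2       ≡⟨ ℕₚ.*-comm k 2 ⟩
    2 * k       ≡⟨ cong (k +_) (ℕₚ.+-identityʳ k) ⟩
    k + k       ≡⟨ eq ⟩
    q * (m * 2) ≡⟨ ℕₚ.*-assoc q m 2 ⟨
    q * m * 2   ∎)
  go : ∀ r t → r ℕ.< 2 → q ≡ r + t * 2 → rotate k i ≡ i ⊎ rotate k i ≡ rotate m i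
  go r t r<2 q≡ = case r<2 of λ
    { (ℕ.s≤s ℕ.z≤n)            → inj₁ (trans (split 0 q≡) (fixed i))
    ; (ℕ.s≤s (ℕ.s≤s ℕ.z≤n)) → inj₂ (trans (split 1 q≡)
        (trans (cong (rotate (1 * m)) (fixed i))
               (cong (λ l → rotate l i) (ℕₚ.*-identityˡ m)))) }
    where
    fixed : ∀ i → rotate (t * (m * 2)) i ≡ i
    fixed i = ∣⇒rotate-fixed i (divides t refl)
    split : ∀ r → q ≡ r + t * 2 → rotate k i ≡ rotate (r * m) (rotate (t * (m * 2)) i)
    split r q≡ = trans (cong (λ l → rotate l i) (begin
      k                     ≡⟨ k≡ ⟩
      q * m                 ≡⟨ cong (_* m) q≡ ⟩
      (r + t * 2) * m       ≡⟨ ℕₚ.*-distribʳ-+ m r (t * 2) ⟩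
      r * m + t * 2 * m     ≡⟨ cong (r * m +_) (trans (ℕₚ.*-assoc t 2 m)
                                 (cong (t *_) (ℕₚ.*-comm 2 m))) ⟩
      r * m + t * (m * 2)   ∎)) (rotate-+ (r * m) (t * (m * 2)) i)

-- Parity

odd : ℕ → Bool
odd zero    = false
odd (suc k) = not (odd k)

odd-*2 : ∀ k → odd (k * 2) ≡ false
odd-*2 zero    = refl
odd-*2 (suc k) = trans (Boolₚ.not-involutive _) (odd-*2 k)

¬∣⇒odd : ∀ k → ¬ 2 ∣ k → odd k ≡ true
¬∣⇒odd zero          ¬2∣ = contradiction (2 ∣0) ¬2∣
¬∣⇒odd (suc zero)    ¬2∣ = refl
¬∣⇒odd (suc (suc k)) ¬2∣ = trans (Boolₚ.not-involutive _)
  (¬∣⇒odd k λ 2∣k → ¬2∣ (∣m∣n⇒∣m+n ∣-refl 2∣k))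

count : ∀ {n} → (Fin n → Bool) → ℕ
count {zero}  f = 0
count {suc n} f = (if f zero then 1 else 0) + count (f ∘ suc)

count-cong : ∀ {n} {f g : Fin n → Bool} → (∀ i → f i ≡ g i) → count f ≡ count g
count-cong {zero}  eq = refl
count-cong {suc n} eq = cong₂ (λ x y → (if x then 1 else 0) + y) (eq zero) (count-cong (eq ∘ suc))

count-true : ∀ n → count {n} (λ _ → true) ≡ n
count-true zero    = refl
count-true (suc n) = cong suc (count-true n)

count-drop : ∀ {n} {f g : Fin n → Bool} i → f i ≡ true → g i ≡ false →
  (∀ j → j ≢ i → f j ≡ g j) → count f ≡ suc (count g)
count-drop zero fi gi eq rewrite fi | gi =
  cong suc (count-cong λ j → eq (suc j) λ ())
count-drop {f = f} {g} (suc i) fi gi eq = trans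
  (cong₂ (λ x y → (if x then 1 else 0) + y) (eq zero λ ())
         (count-drop i fi gi λ j j≢i → eq (suc j) (j≢i ∘ Finₚ.suc-injective)))
  (ℕₚ.+-suc (if g zero then 1 else 0) _)

odd-count : ∀ {n} (f : Fin n → Bool) → odd (count f) ≡ sum f
odd-count {zero}  f = refl
odd-count {suc n} f with f zero
... | true  = trans (cong not (odd-count (f ∘ suc))) (sym (Boolₚ.true-xor _))
... | false = odd-count (f ∘ suc)

-- Around a closed cycle every value of `f` enters the exclusive-or twice and cancels.
even-changes : ∀ {n} (f : Fin n → Bool) → odd (count λ i → f i xor f (succ i)) ≡ false
even-changes f = begin
  odd (count λ i → f i xor f (succ i)) ≡⟨ odd-count (λ i → f i xor f (succ i)) ⟩
  sum (λ i → f i xor f (succ i))       ≡⟨ ∑-distrib-+ f (f ∘ succ) ⟩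
  sum f xor sum (f ∘ succ)             ≡⟨ cong (sum f xor_) (sum-permute f succ-permutation) ⟨
  sum f xor sum f                      ≡⟨ Boolₚ.xor-same (sum f) ⟩
  false                                ∎
  where open ≡-Reasoning

-- Positions on the board

infixl 7 _⊙_
-- Multiplication of signs, with `fwd` as plus and `bwd` as minus.
_⊙_ : Direction → Direction → Direction
fwd ⊙ s = s
bwd ⊙ s = flip s

⊙-flipˡ : ∀ r s → flip r ⊙ s ≡ flip (r ⊙ s)
⊙-flipˡ fwd s = refl
⊙-flipˡ bwd s = sym (flip-involutive s)

⊙-involutive : ∀ r s → r ⊙ (r ⊙ s) ≡ s
⊙-involutive fwd s = refl
⊙-involutive bwd s = flip-involutive s

⊙-same : ∀ s → fwd ≡ s ⊙ s
⊙-same fwd = refl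
⊙-same bwd = refl

⊙-distinct : ∀ s → bwd ≡ flip s ⊙ s
⊙-distinct fwd = refl
⊙-distinct bwd = refl

⊙≡fwd : ∀ {r s} → fwd ≡ r ⊙ s → r ≡ s
⊙≡fwd {fwd} refl = refl
⊙≡fwd {bwd} {bwd} refl = refl

⊙≡bwd : ∀ {r s} → bwd ≡ r ⊙ s → r ≡ flip s
⊙≡bwd {fwd} refl = refl
⊙≡bwd {bwd} {fwd} refl = refl

module Chorded (n : ℕ) (n≥4 : 4 ≤ n) (a b : Fin n) (a<b : a < b)
               (nonadjacent : ¬ CycleAdjacent a b) where

  open ChordBoard n a b a<b nonadjacent
    hiding (Dart; src; next; cell; rev; pred-succ; arc; loopless; cell-onto)
  open Board board using (Dart; src; tgt; rev; cell; loopless)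
  open Game board
  open Play board

  -- The two arcs between the ends of the chord.

  end : Direction → Fin n
  end r = src (chord r)

  ends : ∀ i → (∃[ r ] i ≡ end r) ⊎ (∀ r → i ≢ end r)
  ends i with place i
  ... | at-a p  = inj₁ (fwd , p)
  ... | at-b p  = inj₁ (bwd , p)
  ... | off p q = inj₂ λ { fwd → p ; bwd → q }

  end-gap : ∀ r r′ → succ (end r) ≢ end r′
  end-gap fwd fwd p = succ≢ a (sym p)
  end-gap fwd bwd p = nonadjacent (inj₁ (sym p))
  end-gap bwd fwd p = nonadjacent (inj₂ (sym p))
  end-gap bwd bwd p = succ≢ b (sym p)

  -- `arc i ≡ r` says that side i lies between end r and end (flip r), in
  -- cyclic order.
  arc : Fin n → Direction
  arc i = if does (cell (side i fwd) Finₚ.≟ suc zero) then fwd else bwd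

  inner : Direction → Fin 2
  inner fwd = zero
  inner bwd = suc zero

  cell-side : ∀ i → cell (side i fwd) ≡ suc (inner (arc i))
  cell-side i with ChordBoard.arc n a b a<b nonadjacent i
  ... | low p   rewrite below p    = refl
  ... | mid p q rewrite inside p q = refl
  ... | high p  rewrite above p    = refl

  private
    arc-of : ∀ {i d} → cell (side i fwd) ≡ cell d →
             arc i ≡ (if does (cell d Finₚ.≟ suc zero) then fwd else bwd)
    arc-of eq = cong (λ c → if does (c Finₚ.≟ suc zero) then fwd else bwd) eq

  arc-end : ∀ r → arc (end r) ≡ r
  arc-end fwd = arc-of {d = chord bwd} (inside ℕₚ.≤-refl a<b)
  arc-end bwd = arc-of {d = chord fwd} (above ℕₚ.≤-refl)

  arc-succ : ∀ {i} → (∀ r → succ i ≢ end r) → arc (succ i) ≡ arc i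
  arc-succ {i} ¬end = arc-of {d = side i fwd}
    (trans (cong cell (sym (depart-side (¬end fwd) (¬end bwd)))) (cell-next (side i fwd)))

  arc-before : ∀ r {i} → succ i ≡ end r → arc i ≡ flip r
  arc-before fwd {i} p = arc-of {d = chord fwd}
    (trans (sym (cell-next (side i fwd))) (cong cell (trans (cong depart p) depart-a)))
  arc-before bwd {i} p = arc-of {d = chord bwd}
    (trans (sym (cell-next (side i fwd))) (cong cell (trans (cong depart p) depart-b)))

  arc-after : ∀ r → arc (succ (end r)) ≡ r
  arc-after r = trans (arc-succ (end-gap r)) (arc-end r)

  arc-pred : ∀ r → arc (pred (end r)) ≡ flip r
  arc-pred r = arc-before r (succ-pred (end r))

  arc-pred² : ∀ r → arc (pred (pred (end r))) ≡ flip r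
  arc-pred² r = trans (sym (arc-succ λ r′ p → end-gap r′ r
      (trans (cong succ (trans (sym p) (succ-pred _))) (succ-pred (end r)))))
    (trans (cong arc (succ-pred _)) (arc-pred r))

  -- Cyclic induction from `end r`, with membership in arc `r` as a premise: at `end (flip r)` the
  -- premise fails, and back at `end r` the base case applies again.
  arc-induction : ∀ r {P : Fin n → Set} → P (end r) →
    (∀ j → succ j ≢ end (flip r) → P j → P (succ j)) → ∀ j → arc j ≡ r → P j
  arc-induction r {P} base step = succ-induction (end r) (λ _ → base) λ j ih eq →
    case ends (succ j) of λ
      { (inj₁ (q , p)) → case q ≟ᵈ r of λ
          { (yes refl) → subst P (sym p) base
          ; (no q≢r)   → contradiction (trans (sym (arc-end q)) (trans (cong arc (sym p)) eq)) q≢r }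
      ; (inj₂ ¬end) → step j (¬end (flip r)) (ih (trans (sym (arc-succ ¬end)) eq)) }

  two-sides : ∀ r → succ (succ (end r)) ≡ end (flip r) →
    ∀ j → arc j ≡ r → j ≡ end r ⊎ j ≡ succ (end r)
  two-sides r len = arc-induction r (inj₁ refl) λ
    { j _ (inj₁ refl)  → inj₂ refl
    ; j ¬e (inj₂ refl) → contradiction len ¬e }

  three-sides : ∀ r → succ (succ (succ (end r))) ≡ end (flip r) →
    ∀ j → arc j ≡ r → j ≡ end r ⊎ j ≡ succ (end r) ⊎ j ≡ succ (succ (end r))
  three-sides r len = arc-induction r (inj₁ refl) λ
    { j _ (inj₁ refl)         → inj₂ (inj₁ refl)
    ; j _ (inj₂ (inj₁ refl))  → inj₂ (inj₂ refl)
    ; j ¬e (inj₂ (inj₂ refl)) → contradiction len ¬e }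

  -- Legal moves and the parity of the unmarked sides.

  record Valid (h : History) : Set where
    field
      consistent : ∀ d → d ∈ h → rev d ∉ h
      noSink     : ∀ v → ¬ Sink h v
      noSource   : ∀ v → ¬ Source h v

  open Valid

  valid-[] : Valid []
  valid-[] = record
    { consistent = λ _ () ; noSink = λ v f → case f (side v bwd) refl of λ ()
    ; noSource = λ v f → case f (side v fwd) refl of λ () }

  valid-∷ : ∀ {h d} → Valid h → Legal h d → Valid (d ∷ h)
  valid-∷ {h} {d} v (legal (d∉h , rd∉h) sink source) = record
    { consistent = consistent′ ; noSink = sink ; noSource = source }
    where
    consistent′ : ∀ e → e ∈ d ∷ h → rev e ∉ d ∷ h
    consistent′ e (here refl) (here eq)  = flip-≢ _ (cong proj₂ eq)
    consistent′ e (here refl) (there q)  = rd∉h q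
    consistent′ e (there p)   (here refl) = rd∉h (subst (_∈ h) (sym (rev-involutive e)) p)
    consistent′ e (there p)   (there q)  = consistent v e p q

  Unmarked : History → Fin n → Set
  Unmarked h i = ∀ s → side i s ∉ h

  unmarked? : ∀ h i → Dec (Unmarked h i)
  unmarked? h i = all-directions? λ s → ¬? (side i s ∈? h)

  legal⇒unmarked : ∀ {h i s} → Legal h (side i s) → Unmarked h i
  legal⇒unmarked {s = fwd} (legal (p , q) _ _) fwd = p
  legal⇒unmarked {s = fwd} (legal (p , q) _ _) bwd = q
  legal⇒unmarked {s = bwd} (legal (p , q) _ _) fwd = q
  legal⇒unmarked {s = bwd} (legal (p , q) _ _) bwd = p

  unmarked-tail : ∀ {h d i} → Unmarked (d ∷ h) i → Unmarked h i
  unmarked-tail u s = u s ∘ there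

  -- Marking `d` can create a sink only at its target and a source only at its starting vertex, and
  -- one absent dart at each of them prevents this.
  legal-by-witnesses : ∀ {h d} → Valid h → d ∉ h → rev d ∉ h →
    ∃[ e ] (tgt e ≡ tgt d × e ≢ d × e ∉ h) →
    ∃[ e ] (src e ≡ src d × e ≢ d × e ∉ h) → Legal h d
  legal-by-witnesses {h} {d} v d∉h rd∉h (e , te , e≢d , e∉h) (e′ , se , e′≢d , e′∉h) =
    legal (d∉h , rd∉h) sink source
    where
    sink : ∀ u → ¬ Sink (d ∷ h) u
    sink u f = case tgt d Finₚ.≟ u of λ
      { (yes refl) → case f e te of λ { (here eq) → e≢d eq ; (there p) → e∉h p }
      ; (no t≢u) → noSink v u λ g tg → case f g tg of λ
          { (here refl) → contradiction tg t≢u ; (there p) → p } }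
    source : ∀ u → ¬ Source (d ∷ h) u
    source u f = case src d Finₚ.≟ u of λ
      { (yes refl) → case f e′ se of λ { (here eq) → e′≢d eq ; (there p) → e′∉h p }
      ; (no t≢u) → noSource v u λ g tg → case f g tg of λ
          { (here refl) → contradiction tg t≢u ; (there p) → p } }

  blanks : History → ℕ
  blanks h = count λ i → does (unmarked? h i)

  blanks-∷ : ∀ {h i s} → Unmarked h i → blanks h ≡ suc (blanks (side i s ∷ h))
  blanks-∷ {h} {i} {s} u = count-drop i
    (dec-true (unmarked? h i) u)
    (dec-false (unmarked? (side i s ∷ h) i) λ u′ → u′ s (here refl))
    λ j j≢i → does-⇔ (mk⇔
      (λ { w t (here eq) → j≢i (Finₚ.suc-injective (cong proj₁ eq)) ; w t (there p) → w t p })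
      unmarked-tail) (unmarked? h j) (unmarked? (side i s ∷ h) j)

  -- If adjacent arrows always agree, then the arrows change sign exactly at the
  -- blocked unmarked sides.
  unblocked : ∀ {h} →
    (∀ i s → side i s ∈ h → side i (flip s) ∉ h) →
    (∀ i s → side i s ∈ h → side (succ i) (flip s) ∉ h) →
    odd (blanks h) ≡ true →
    ∃[ i ] ∃[ s ] (Unmarked h i × side (pred i) (flip s) ∉ h × side (succ i) (flip s) ∉ h)
  unblocked {h} consistent chain odd-blanks
    with any? (λ i → any-direction? λ s → unmarked? h i ×-dec
                 ¬? (side (pred i) (flip s) ∈? h) ×-dec ¬? (side (succ i) (flip s) ∈? h))
  ... | yes move = move
  ... | no stuck = contradiction
    (trans (sym odd-blanks)
      (trans (cong odd (count-cong change)) (even-changes forward))) λ ()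
    where
    -- An unmarked side borrows the direction of the side before it.
    forward : Fin n → Bool
    forward i = if does (unmarked? h i) then does (side (pred i) fwd ∈? h)
                                        else does (side i fwd ∈? h)

    marked : ∀ {i} → ¬ Unmarked h i → ∃[ s ] side i s ∈ h
    marked {i} ¬u with any-direction? (λ s → side i s ∈? h)
    ... | yes m = m
    ... | no ¬m = contradiction (λ s p → ¬m (s , p)) ¬u

    -- As neither direction is free, some neighbour carries `fwd` and some neighbour carries `bwd`;
    -- these are different neighbours, since no side carries both.
    blocked : ∀ i → Unmarked h i →
      ∃[ s ] (side (pred i) s ∈ h × side (succ i) (flip s) ∈ h)
    blocked i u
      with any-direction? (λ s → side (pred i) s ∈? h ×-dec side (succ i) (flip s) ∈? h)
    ... | yes b = b
    ... | no ¬b = contradiction (i , free) stuck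
      where
      free : ∃[ s ] (Unmarked h i × side (pred i) (flip s) ∉ h × side (succ i) (flip s) ∉ h)
      free with side (pred i) fwd ∈? h | side (succ i) fwd ∈? h
      ... | yes p | _     = fwd , u , consistent _ _ p , λ q → ¬b (fwd , p , q)
      ... | no ¬p | no ¬q = bwd , u , ¬p , ¬q
      ... | no ¬p | yes q = fwd , u , (λ p → ¬b (bwd , p , q)) , consistent _ _ q


    forward-unmarked : ∀ {i} → Unmarked h i → forward i ≡ does (side (pred i) fwd ∈? h)
    forward-unmarked {i} u = cong
      (λ x → if x then does (side (pred i) fwd ∈? h) else does (side i fwd ∈? h))
      (dec-true (unmarked? h i) u)

    forward-marked : ∀ {i} → ¬ Unmarked h i → forward i ≡ does (side i fwd ∈? h)
    forward-marked {i} ¬u = cong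
      (λ x → if x then does (side (pred i) fwd ∈? h) else does (side i fwd ∈? h))
      (dec-false (unmarked? h i) ¬u)

    arrow : ∀ {i s} → side i s ∈ h → does (side i fwd ∈? h) ≡ does (s ≟ᵈ fwd)
    arrow {s = fwd} p = dec-true (_ ∈? h) p
    arrow {s = bwd} p = dec-false (_ ∈? h) (consistent _ _ p)

    differ : ∀ s → true ≡ does (s ≟ᵈ fwd) xor does (flip s ≟ᵈ fwd)
    differ fwd = refl
    differ bwd = refl

    agree : ∀ {i s t} → side i s ∈ h → side (succ i) t ∈ h → s ≡ t
    agree {s = s} {t} p q with t ≟ᵈ flip s
    ... | yes refl = contradiction q (chain _ _ p)
    ... | no ¬eq   = trans (sym (flip-involutive s)) (sym (≢⇒flip ¬eq))

    -- A marked side passes its direction on to the next one, while across a blocked unmarked side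
    -- the direction flips. So the unmarked sides are the changes of `forward`, and these are even
    -- in number.
    change : ∀ i → does (unmarked? h i) ≡ forward i xor forward (succ i)
    change i = go (unmarked? h i) (unmarked? h (succ i))
      where
      go : Dec (Unmarked h i) → Dec (Unmarked h (succ i)) →
           does (unmarked? h i) ≡ forward i xor forward (succ i)
      go (yes u) (yes w) = let (s , _ , q) = blocked i u in contradiction q (w (flip s))
      go (yes u) (no ¬w) = let (s , p , q) = blocked i u in
        trans (dec-true (unmarked? h i) u) (trans (differ s)
          (sym (cong₂ _xor_ (trans (forward-unmarked u) (arrow p))
                            (trans (forward-marked ¬w) (arrow q)))))
      go (no ¬u) (yes w) = trans (dec-false (unmarked? h i) ¬u)
        (trans (sym (Boolₚ.xor-same (does (side i fwd ∈? h))))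
          (sym (cong₂ _xor_ (forward-marked ¬u) (trans (forward-unmarked w)
            (cong (λ j → does (side j fwd ∈? h)) (pred-succ i))))))
      go (no ¬u) (no ¬w) =
        let (s , p) = marked ¬u
            (t , q) = marked ¬w
        in trans (dec-false (unmarked? h i) ¬u) (trans (sym (Boolₚ.xor-same (does (s ≟ᵈ fwd))))
          (sym (cong₂ _xor_ (trans (forward-marked ¬u) (arrow p))
            (trans (forward-marked ¬w) (trans (arrow q)
              (cong (λ x → does (x ≟ᵈ fwd)) (sym (agree p q))))))))

  -- Once the chord is marked by `chord c`, two consecutive sides may carry
  -- opposite arrows only at an end r of the chord, and then only with the arrow
  -- r ⊙ c on the first side: both point towards end r if the chord leaves it,
  -- and away from it otherwise.
  module Marked (c : Direction) where

    -- Such arrows both point into the common vertex or both out of it. As it is neither a sink nor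
    -- a source, it must be an end of the chord, with the chord's arrow pointing the other way.
    conflict : ∀ {h i s} → Valid h → chord c ∈ h →
      side i s ∈ h → side (succ i) (flip s) ∈ h → ∃[ r ] (succ i ≡ end r × s ≡ r ⊙ c)
    conflict {h} {i} {s} v c∈h p q
      with any-direction? (λ r → succ i Finₚ.≟ end r ×-dec s ≟ᵈ r ⊙ c)
    ... | yes e = e
    ... | no ¬e = ⊥-elim (refute s p q ¬e)
      where
      refute : ∀ s → side i s ∈ h → side (succ i) (flip s) ∈ h →
               ¬ (∃[ r ] (succ i ≡ end r × s ≡ r ⊙ c)) → ⊥
      refute fwd p q ¬e = noSink v (succ i) λ
        { (side j fwd) eq → subst (λ k → side k fwd ∈ h) (sym (succ-injective eq)) p
        ; (side j bwd) refl → q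
        ; (chord r) eq → case r ≟ᵈ c of λ
            { (yes refl) → c∈h
            ; (no r≢c) → contradiction (flip r , sym eq , into (≢⇒flip r≢c)) ¬e } }
        where
        into : ∀ {r} → r ≡ flip c → fwd ≡ flip r ⊙ c
        into refl = trans (⊙-same c) (cong (_⊙ c) (sym (flip-involutive c)))
      refute bwd p q ¬e = noSource v (succ i) λ
        { (side j fwd) refl → q
        ; (side j bwd) eq → subst (λ k → side k bwd ∈ h) (sym (succ-injective eq)) p
        ; (chord r) eq → case r ≟ᵈ c of λ
            { (yes refl) → c∈h
            ; (no r≢c) → contradiction (r , sym eq , outof (≢⇒flip r≢c)) ¬e } }
        where
        outof : ∀ {r} → r ≡ flip c → bwd ≡ r ⊙ c
        outof refl = ⊙-distinct c

    -- The last two hypotheses confine opposing neighbours to the exceptional pairs. There the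
    -- absent dart is the reversed chord; elsewhere it is the opposing dart of the neighbouring
    -- side.
    legal-side : ∀ {h i s} → Valid h → chord c ∈ h → Unmarked h i →
      (side (succ i) (flip s) ∈ h → ∃[ r ] (succ i ≡ end r × s ≡ r ⊙ c)) →
      (side (pred i) (flip s) ∈ h → ∃[ r ] (i ≡ end r × flip s ≡ r ⊙ c)) →
      Legal h (side i s)
    legal-side {h} {i} {s} v c∈h u ahead behind =
      legal-by-witnesses v (u s) (u (flip s)) (proj₁ (witnesses s ahead behind))
                                              (proj₂ (witnesses s ahead behind))
      where
      c̄∉h : chord (flip c) ∉ h
      c̄∉h = consistent v _ c∈h
      witnesses : ∀ s →
        (side (succ i) (flip s) ∈ h → ∃[ r ] (succ i ≡ end r × s ≡ r ⊙ c)) →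
        (side (pred i) (flip s) ∈ h → ∃[ r ] (i ≡ end r × flip s ≡ r ⊙ c)) →
        (∃[ e ] (tgt e ≡ tgt (side i s) × e ≢ side i s × e ∉ h)) ×
        ∃[ e ] (src e ≡ src (side i s) × e ≢ side i s × e ∉ h)
      witnesses fwd ahead behind = ahead′ , behind′
        where
        ahead′ : ∃[ e ] (tgt e ≡ succ i × e ≢ side i fwd × e ∉ h)
        ahead′ with side (succ i) bwd ∈? h
        ... | no ∉h = side (succ i) bwd , refl , (λ ()) , ∉h
        ... | yes ∈h with ahead ∈h
        ...   | r , p , q with ⊙≡fwd {r} q
        ...     | refl = chord (flip c) , trans (cong end (flip-involutive c)) (sym p) , (λ ()) , c̄∉h
        behind′ : ∃[ e ] (src e ≡ i × e ≢ side i fwd × e ∉ h)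
        behind′ with side (pred i) bwd ∈? h
        ... | no ∉h = side (pred i) bwd , succ-pred i , (λ ()) , ∉h
        ... | yes ∈h with behind ∈h
        ...   | r , p , q with ⊙≡bwd {r} q
        ...     | refl = chord (flip c) , sym p , (λ ()) , c̄∉h
      witnesses bwd ahead behind = behind′ , ahead′
        where
        behind′ : ∃[ e ] (tgt e ≡ i × e ≢ side i bwd × e ∉ h)
        behind′ with side (pred i) fwd ∈? h
        ... | no ∉h = side (pred i) fwd , succ-pred i , (λ ()) , ∉h
        ... | yes ∈h with behind ∈h
        ...   | r , p , q with ⊙≡fwd {r} q
        ...     | refl = chord (flip c) , trans (cong end (flip-involutive c)) (sym p) , (λ ()) , c̄∉h
        ahead′ : ∃[ e ] (src e ≡ succ i × e ≢ side i bwd × e ∉ h)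
        ahead′ with side (succ i) fwd ∈? h
        ... | no ∉h = side (succ i) fwd , refl , (λ ()) , ∉h
        ... | yes ∈h with ahead ∈h
        ...   | r , p , q with ⊙≡bwd {r} q
        ...     | refl = chord (flip c) , sym p , (λ ()) , c̄∉h

    -- The arrow that all sides of arc r must carry to form a cycle cell.
    γ : Direction → Direction
    γ r = flip (r ⊙ c)

    γ-flip : ∀ r → γ (flip r) ≡ r ⊙ c
    γ-flip r = trans (cong flip (⊙-flipˡ r c)) (flip-involutive (r ⊙ c))

    γ-same : ∀ {r} → r ≡ c → γ r ≡ bwd
    γ-same refl = cong flip (sym (⊙-same c))

    γ-opposite : ∀ {r} → flip r ≡ c → γ r ≡ fwd
    γ-opposite {r} refl = cong flip
      (sym (trans (⊙-distinct (flip r)) (cong (_⊙ flip r) (flip-involutive r))))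

    -- Cycle cells, and cells one arrow short of a cycle.

    Full : History → Direction → Set
    Full h r = ∀ i → arc i ≡ r → side i (γ r) ∈ h

    inner-injective : ∀ {q r} → inner q ≡ inner r → q ≡ r
    inner-injective {fwd} {fwd} _ = refl
    inner-injective {bwd} {bwd} _ = refl

    inner-onto : ∀ k → ∃[ r ] inner r ≡ k
    inner-onto zero       = fwd , refl
    inner-onto (suc zero) = bwd , refl

    cell-chord : ∀ q → cell (chord q) ≡ suc (inner (flip q))
    cell-chord fwd = refl
    cell-chord bwd = refl

    in-cell : ∀ {i r} → cell (side i fwd) ≡ suc (inner r) → arc i ≡ r
    in-cell {i} eq = inner-injective (Finₚ.suc-injective (trans (sym (cell-side i)) eq))

    on-cell : ∀ {i r} → arc i ≡ r → cell (side i fwd) ≡ suc (inner r)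
    on-cell {i} refl = cell-side i

    chord-on-cell : ∀ r → cell (chord (flip r)) ≡ suc (inner r)
    chord-on-cell r = trans (cell-chord (flip r)) (cong (suc ∘ inner) (flip-involutive r))

    chord-in-cell : ∀ {q r} → cell (chord q) ≡ suc (inner r) → q ≡ flip r
    chord-in-cell {q} eq = trans (sym (flip-involutive q))
      (cong flip (inner-injective (Finₚ.suc-injective (trans (sym (cell-chord q)) eq))))

    -- The boundary of the cell at arc `r` consists of the forward sides and `chord (flip r)`.
    -- Whether `c` is that dart or its reverse fixes the sense in which the cell can cycle.
    full⇒cyclic : ∀ {h r} → chord c ∈ h → Full h r → Cyclic h
    full⇒cyclic {h} {r} c∈h full with r ≟ᵈ c
    ... | yes r≡c = inner r , inj₂ λ
      { (side i fwd) eq → subst (λ s → side i s ∈ h) (γ-same r≡c) (full i (in-cell eq))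
      ; (chord q) eq → subst (λ s → chord s ∈ h)
          (trans (sym r≡c) (trans (sym (flip-involutive r)) (cong flip (sym (chord-in-cell eq))))) c∈h }
    ... | no r≢c = inner r , inj₁ λ
      { (side i fwd) eq → subst (λ s → side i s ∈ h) (γ-opposite r̄≡c) (full i (in-cell eq))
      ; (chord q) eq → subst (λ s → chord s ∈ h) (trans (sym r̄≡c) (sym (chord-in-cell eq))) c∈h }
      where
      r̄≡c : flip r ≡ c
      r̄≡c = trans (cong flip (≢⇒flip r≢c)) (flip-involutive c)

    chord-unique : ∀ {h q} → Valid h → chord c ∈ h → chord q ∈ h → q ≡ c
    chord-unique {q = q} v p q∈h with q ≟ᵈ c
    ... | yes eq = eq
    ... | no ¬eq = contradiction (subst (λ x → chord x ∈ _) (≢⇒flip ¬eq) q∈h) (consistent v _ p)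

    cyclic⇒full : ∀ {h} → Valid h → chord c ∈ h → Cyclic h → ∃[ r ] Full h r
    cyclic⇒full {h} v c∈h (k , cyc) with inner-onto k
    cyclic⇒full {h} v c∈h (k , inj₁ f) | r , refl = r , λ i eq →
      subst (λ s → side i s ∈ h)
        (sym (γ-opposite (chord-unique v c∈h (f (chord (flip r)) (chord-on-cell r)))))
        (f (side i fwd) (on-cell eq))
    cyclic⇒full {h} v c∈h (k , inj₂ f) | r , refl = r , λ i eq →
      subst (λ s → side i s ∈ h)
        (sym (γ-same (chord-unique v c∈h (subst (λ q → chord q ∈ h) (flip-involutive r)
          (f (chord (flip r)) (chord-on-cell r))))))
        (f (side i fwd) (on-cell eq))

    record Almost (h : History) (r : Direction) (j : Fin n) : Set where
      constructor almost
      field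
        in-arc : arc j ≡ r
        free   : Unmarked h j
        rest   : ∀ i → arc i ≡ r → i ≢ j → side i (γ r) ∈ h

    open Almost

    almost? : ∀ h → Dec (∃[ r ] ∃[ j ] Almost h r j)
    almost? h = any-direction? λ r → any? λ j →
      map′ (λ (x , y , z) → almost x y z) (λ (almost x y z) → x , y , z)
        (arc j ≟ᵈ r ×-dec unmarked? h j ×-dec
         all? λ i → arc i ≟ᵈ r →-dec (¬? (i Finₚ.≟ j) →-dec side i (γ r) ∈? h))

    -- Neighbours of `j` inside the arc carry `γ r` themselves. Across an end, an opposing arrow
    -- forms the exceptional pair, which consists of the `γ` arrows of the two arcs.
    complete-legal : ∀ {h r j} → Valid h → chord c ∈ h → Almost h r j →
                     Legal h (side j (γ r))
    complete-legal {h} {r} {j} v c∈h al = legal-side v c∈h (free al) ahead behind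
      where
      ahead : side (succ j) (flip (γ r)) ∈ h → ∃[ q ] (succ j ≡ end q × γ r ≡ q ⊙ c)
      ahead p with ends (succ j)
      ... | inj₁ (q , eq) = q , eq , trans (cong γ (trans (sym (in-arc al)) (arc-before q eq))) (γ-flip q)
      ... | inj₂ ¬end = contradiction p (consistent v _
        (rest al (succ j) (trans (arc-succ ¬end) (in-arc al)) (succ≢ j ∘ sym)))
      behind : side (pred j) (flip (γ r)) ∈ h → ∃[ q ] (j ≡ end q × flip (γ r) ≡ q ⊙ c)
      behind p with ends j
      ... | inj₁ (q , refl) = q , refl ,
        trans (flip-involutive _) (cong (_⊙ c) (trans (sym (in-arc al)) (arc-end q)))
      ... | inj₂ ¬end = contradiction p (consistent v _
        (rest al (pred j) (trans (sym (arc-succ λ q eq → ¬end q (trans (sym (succ-pred j)) eq)))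
                                 (trans (cong arc (succ-pred j)) (in-arc al)))
          λ eq → succ≢ (pred j) (trans eq (sym (succ-pred j)))))

    complete-cyclic : ∀ {h r j} → chord c ∈ h → Almost h r j → Cyclic (side j (γ r) ∷ h)
    complete-cyclic {h} {r} {j} c∈h al = full⇒cyclic (there c∈h) λ i eq →
      case i Finₚ.≟ j of λ { (yes refl) → here refl ; (no i≢j) → there (rest al i eq i≢j) }

    record Quiet (h : History) : Set where
      field
        valid    : Valid h
        charged  : chord c ∈ h
        noAlmost : ∀ r j → ¬ Almost h r j

    open Quiet

    -- A cycle cell after the move would have been there before, or would have lacked only side `i`,
    -- which `noAlmost` excludes.
    still-acyclic : ∀ {h i s} → Quiet h → ¬ Cyclic h → Legal h (side i s) →
                    ¬ Cyclic (side i s ∷ h)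
    still-acyclic {h} {i} {s} Q ¬cyc L cyc
      with cyclic⇒full (valid-∷ (valid Q) L) (there (charged Q)) cyc
    ... | r , full with arc i ≟ᵈ r
    ...   | yes eq = noAlmost Q r i (almost eq (legal⇒unmarked L) λ j eq′ j≢i →
      case full j eq′ of λ { (here e) → contradiction (Finₚ.suc-injective (cong proj₁ e)) j≢i
                           ; (there p) → p })
    ...   | no ¬eq = ¬cyc (full⇒cyclic (charged Q) λ j eq →
      case full j eq of λ { (here e) → contradiction
                              (trans (cong arc (sym (Finₚ.suc-injective (cong proj₁ e)))) eq) ¬eq
                          ; (there p) → p })

    -- Completing a cell wins, so an opponent who leaves a cell one arrow short
    -- of a cycle loses at once.
    respond : ∀ {p h} → Quiet h → toMove h ≡ opponent p →
      (∀ {i s} → Legal h (side i s) → Quiet (side i s ∷ h) → ¬ Cyclic (side i s ∷ h) →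
        toMove (side i s ∷ h) ≡ p → Win p (side i s ∷ h)) →
      Win p h
    respond {p} {h} Q theirs answer = await theirs go
      where
      go : ∀ d → ¬ Finished h → Legal h d → Win p (d ∷ h)
      go (chord q) nf (legal (∉h , r∉h) _ _) with q ≟ᵈ c
      ... | yes refl = contradiction (charged Q) ∉h
      ... | no ¬eq   = contradiction
        (subst (λ x → chord x ∈ h) (trans (sym (flip-involutive c)) (cong flip (sym (≢⇒flip ¬eq))))
          (charged Q)) r∉h
      go (side i s) nf L = decide (almost? (side i s ∷ h))
        where
        mine : toMove (side i s ∷ h) ≡ p
        mine = trans (cong opponent theirs) (opponent-involutive p)
        ¬cyc : ¬ Cyclic (side i s ∷ h)
        ¬cyc = still-acyclic Q (nf ∘ inj₁) L
        v : Valid (side i s ∷ h)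
        v = valid-∷ (valid Q) L
        decide : Dec (∃[ r ] ∃[ j ] Almost (side i s ∷ h) r j) → Win p (side i s ∷ h)
        decide (no none) = answer L (record
          { valid = v ; charged = there (charged Q) ; noAlmost = λ r j al → none (r , j , al) })
          ¬cyc mine
        decide (yes (r , j , al)) =
          -- The completed cell ends the game, so the tree below has no branches.
          reply mine ¬cyc _ (complete-legal v (there (charged Q)) al)
            (await (cong opponent mine) λ d nf′ _ →
              contradiction (inj₁ (complete-cyclic (there (charged Q)) al)) nf′)

    -- The two adjacent sides at end r can no longer carry opposite arrows.
    Dead : History → Direction → Set
    Dead h r = side (end r) (r ⊙ c) ∈ h ⊎ side (pred (end r)) (flip (r ⊙ c)) ∈ h

    dead? : ∀ h r → Dec (Dead h r)
    dead? h r = side (end r) (r ⊙ c) ∈? h ⊎-dec side (pred (end r)) (flip (r ⊙ c)) ∈? h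

    dead-∷ : ∀ {h d} r → Dead h r → Dead (d ∷ h) r
    dead-∷ _ (inj₁ p) = inj₁ (there p)
    dead-∷ _ (inj₂ p) = inj₂ (there p)

    -- The arrow that makes an end dead contradicts one member of the exceptional pair. Consistency
    -- is assumed separately because `filled` in `Danger` is not shown to be `Valid`.
    dead⇒agree : ∀ {h i s} →
      (∀ i s → side i s ∈ h → side i (flip s) ∉ h) → (∀ r → Dead h r) →
      (∃[ r ] (succ i ≡ end r × s ≡ r ⊙ c)) → side i s ∈ h → side (succ i) (flip s) ∉ h
    dead⇒agree {h} {i} con dead (r , eq , refl) p q with dead r
    ... | inj₁ m = con _ _ (subst (λ j → side j (r ⊙ c) ∈ h) (sym eq) m) q
    ... | inj₂ m = con _ _ p (subst (λ j → side j (flip (r ⊙ c)) ∈ h)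
                                    (trans (cong pred (sym eq)) (pred-succ i)) m)

    spoilt : ∀ {h r i j} → Valid h → arc i ≡ r → side i (flip (γ r)) ∈ h → ¬ Almost h r j
    spoilt {i = i} {j} v eq p al with i Finₚ.≟ j
    ... | yes refl = free al _ p
    ... | no i≢j   = consistent v _ (rest al i eq i≢j) p

    quiet-∷ : ∀ {h i s} → Quiet h → Legal h (side i s) →
      (∀ r j → ¬ Almost (side i s ∷ h) r j) → Quiet (side i s ∷ h)
    quiet-∷ Q L none = record
      { valid = valid-∷ (valid Q) L ; charged = there (charged Q) ; noAlmost = none }

    odd-∷ : ∀ {h i s b} → Legal h (side i s) → odd (blanks h) ≡ b →
            odd (blanks (side i s ∷ h)) ≡ not b
    odd-∷ {h} {i} {s} L refl rewrite blanks-∷ {s = s} (legal⇒unmarked L) =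
      sym (Boolₚ.not-involutive _)

    -- The endgame with both ends dead.

    Good : History → Set
    Good h = ∃[ i ] ∃[ s ] (Legal h (side i s) × ∀ r j → ¬ Almost (side i s ∷ h) r j)

    module _ {h} (Q : Quiet h) (dead : ∀ r → Dead h r) (odd-blanks : odd (blanks h) ≡ true) where

      private
        con : ∀ i s → side i s ∈ h → side i (flip s) ∉ h
        con i s = consistent (valid Q) (side i s)

        chain : ∀ i s → side i s ∈ h → side (succ i) (flip s) ∉ h
        chain i s p q = dead⇒agree con dead (conflict (valid Q) (charged Q) p q) p q

        unblocked-legal : ∀ {i s} → Unmarked h i →
          side (pred i) (flip s) ∉ h → side (succ i) (flip s) ∉ h → Legal h (side i s)
        unblocked-legal u p q = legal-side (valid Q) (charged Q) u
          (λ m → contradiction m q) (λ m → contradiction m p)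

        -- Two sides i and j are all that arc q lacks: the hero must not play
        -- there.  Filling them in does not change the parity, so there is
        -- another move.
        module Danger {q i j} (i≢j : i ≢ j) (arc-i : arc i ≡ q) (arc-j : arc j ≡ q)
                      (ui : Unmarked h i) (uj : Unmarked h j)
                      (others : ∀ l → arc l ≡ q → l ≢ i → l ≢ j → side l (γ q) ∈ h) where

          filled : History
          filled = side i (γ q) ∷ side j (γ q) ∷ h

          fill : ∀ l → arc l ≡ q → side l (γ q) ∈ filled
          fill l eq with l Finₚ.≟ i | l Finₚ.≟ j
          ... | yes refl | _        = here refl
          ... | no _     | yes refl = there (here refl)
          ... | no l≢i   | no l≢j   = there (there (others l eq l≢i l≢j))

          inside-q : ∀ {l s} → arc l ≡ q → side l s ∈ filled → s ≡ γ q
          inside-q eq (here refl)         = refl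
          inside-q eq (there (here refl)) = refl
          inside-q {l} {s} eq (there (there p)) with s ≟ᵈ γ q
          ... | yes s≡γ = s≡γ
          ... | no s≢γ  = contradiction
            (subst (λ t → side l t ∈ h) (≢⇒flip s≢γ) p)
            (con _ _ (others l eq (λ { refl → ui _ p }) (λ { refl → uj _ p })))

          outside-q : ∀ {l s} → arc l ≢ q → side l s ∈ filled → side l s ∈ h
          outside-q ¬eq (here refl)         = contradiction arc-i ¬eq
          outside-q ¬eq (there (here refl)) = contradiction arc-j ¬eq
          outside-q ¬eq (there (there p))   = p

          con′ : ∀ l s → side l s ∈ filled → side l (flip s) ∉ filled
          con′ l s p p̄ with arc l ≟ᵈ q
          ... | yes eq = flip-≢ s (trans (inside-q eq p̄) (sym (inside-q eq p)))
          ... | no ¬eq = con l s (outside-q ¬eq p) (outside-q ¬eq p̄)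

          -- Inside arc `q` all arrows of `filled` agree. At an end, one of the two sides lies in
          -- arc `q` and carries `γ q`, which is its arrow in the exceptional pair.
          conflict′ : ∀ {l s} → side l s ∈ filled → side (succ l) (flip s) ∈ filled →
                      ∃[ r ] (succ l ≡ end r × s ≡ r ⊙ c)
          conflict′ {l} {s} p p̄ with ends (succ l)
          ... | inj₂ ¬end = case arc l ≟ᵈ q of λ
            { (yes eq) → contradiction
                (trans (inside-q (trans (arc-succ ¬end) eq) p̄) (sym (inside-q eq p))) (flip-≢ s)
            ; (no ¬eq) → conflict (valid Q) (charged Q) (outside-q ¬eq p)
                (outside-q (¬eq ∘ trans (sym (arc-succ ¬end))) p̄) }
          ... | inj₁ (r , eq) = r , eq , (case r ≟ᵈ q of λ
            { (yes refl) → trans (sym (flip-involutive s)) (trans (cong flip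
                (inside-q (trans (cong arc eq) (arc-end r)) p̄)) (flip-involutive _))
            ; (no r≢q) → trans (inside-q (trans (arc-before r eq)
                (trans (cong flip (≢⇒flip r≢q)) (flip-involutive q))) p)
                (trans (cong γ (trans (sym (flip-involutive q)) (cong flip (sym (≢⇒flip r≢q)))))
                       (γ-flip r)) })

          dead′ : ∀ r → Dead filled r
          dead′ r = dead-∷ r (dead-∷ r (dead r))

          odd-filled : odd (blanks filled) ≡ true
          odd-filled = trans (sym (Boolₚ.not-involutive _))
            (trans (sym (cong odd (trans (blanks-∷ uj) (cong suc (blanks-∷ ui′))))) odd-blanks)
            where
            ui′ : Unmarked (side j (γ q) ∷ h) i
            ui′ s (here eq) = i≢j (Finₚ.suc-injective (cong proj₁ eq))
            ui′ s (there p) = ui s p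

          -- The arrow that killed end `q` cannot lie in arc `q`, where only `γ q` occurs. So it
          -- lies in the other arc and runs against the cycle there.
          spoilt-q̄ : ∀ {d k} → Legal h d → ¬ Almost (d ∷ h) (flip q) k
          spoilt-q̄ L with dead q
          ... | inj₁ p = contradiction (inside-q (arc-end q) (there (there p))) (flip-≢ (q ⊙ c) ∘ sym)
          ... | inj₂ p = spoilt (valid-∷ (valid Q) L) (arc-pred q)
            (there (subst (λ s → side _ (flip s) ∈ h) (sym (γ-flip q)) p))

          safe-move : Good h
          -- A side unmarked in `filled` lies outside arc `q`, so that arc still lacks both `i` and
          -- `j` after the move.
          safe-move with unblocked con′
            (λ l s p p̄ → dead⇒agree con′ dead′ (conflict′ p p̄) p p̄) odd-filled
          ... | k , s , u , p , p̄ = k , s , L , none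
            where
            L : Legal h (side k s)
            L = unblocked-legal (unmarked-tail (unmarked-tail u))
                  (p ∘ there ∘ there) (p̄ ∘ there ∘ there)
            lacks : ∀ {l t} → arc l ≡ q → Unmarked h l → side l t ∈ side k s ∷ h → ⊥
            lacks eq ul (here refl) = u _ (fill _ eq)
            lacks eq ul (there m)   = ul _ m
            none : ∀ r m → ¬ Almost (side k s ∷ h) r m
            none r m al with r ≟ᵈ q
            ... | no r≢q = spoilt-q̄ L (subst (λ x → Almost _ x m) (≢⇒flip r≢q) al)
            ... | yes refl with i Finₚ.≟ m
            ...   | yes refl = lacks arc-j uj (rest al j arc-j (i≢j ∘ sym))
            ...   | no i≢m   = lacks arc-i ui (rest al i arc-i i≢m)

      good-move : Good h
      good-move with unblocked con chain odd-blanks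
      ... | i , s , u , p , p̄ with almost? (side i s ∷ h)
      ...   | no none = i , s , unblocked-legal u p p̄ , λ r j al → none (r , j , al)
      ...   | yes (q , j , al) with arc i ≟ᵈ q
      ...     | no ¬eq = contradiction
        (almost (in-arc al) (unmarked-tail (free al)) λ l eq l≢j → case rest al l eq l≢j of λ
          { (here refl) → contradiction eq ¬eq ; (there m) → m })
        (noAlmost Q q j)
      -- The tentative move is itself in arc `q`, which therefore lacks exactly `i` and `j`.
      ...     | yes eq = Danger.safe-move (λ { refl → free al s (here refl) }) eq (in-arc al) u
        (unmarked-tail (free al)) λ l eq′ l≢i l≢j → case rest al l eq′ l≢j of λ
          { (here e) → contradiction (Finₚ.suc-injective (cong proj₁ e)) l≢i ; (there m) → m }

    -- The bound `m` on the unmarked sides drives the recursion and drops at each move of the hero.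
    -- Their number is odd whenever the hero is to move, so `good-move` applies.
    settled-await : ∀ {p} m {h} → blanks h ℕ.≤ m → Quiet h → (∀ r → Dead h r) →
      odd (blanks h) ≡ false → toMove h ≡ opponent p → Win p h
    settled-reply : ∀ {p} m {h} → blanks h ℕ.≤ m → Quiet h → (∀ r → Dead h r) →
      odd (blanks h) ≡ true → ¬ Cyclic h → toMove h ≡ p → Win p h

    settled-await m le Q dead even theirs = respond Q theirs λ L Q′ ¬cyc mine →
      settled-reply m
        (ℕₚ.≤-trans (ℕₚ.n≤1+n _) (subst (ℕ._≤ m) (blanks-∷ (legal⇒unmarked L)) le))
        Q′ (λ r → dead-∷ r (dead r)) (odd-∷ L even) ¬cyc mine

    settled-reply {p} m {h} le Q dead odd-blanks ¬cyc mine
      with good-move Q dead odd-blanks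
    ... | i , s , L , none =
      go m (subst (ℕ._≤ m) (blanks-∷ {s = s} (legal⇒unmarked L)) le)
      where
      go : ∀ m → suc (blanks (side i s ∷ h)) ℕ.≤ m → Win p h
      go (suc m) (ℕ.s≤s le) = reply mine ¬cyc _ L (settled-await m le (quiet-∷ Q L none)
        (λ r → dead-∷ r (dead r)) (odd-∷ L odd-blanks) (cong opponent mine))

    -- Killing the ends of the chord.

    Clear : History → Fin n → Set
    Clear h i = side i (γ (arc i)) ∉ h

    clear⇒∉ : ∀ {h i r} → Clear h i → arc i ≡ r → side i (γ r) ∉ h
    clear⇒∉ cl refl = cl

    clear-elsewhere : ∀ {h i s j} → j ≢ i → Clear h j → Clear (side i s ∷ h) j
    clear-elsewhere j≢i cl (here eq) = j≢i (Finₚ.suc-injective (cong proj₁ eq))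
    clear-elsewhere j≢i cl (there p) = cl p

    clear-harmless : ∀ {h i s j} → s ≢ γ (arc i) → Clear h j → Clear (side i s ∷ h) j
    clear-harmless s≢γ cl (here refl) = s≢γ refl
    clear-harmless s≢γ cl (there p)   = cl p

    -- Room to kill end `r` from the side after it or before it: that side must be available, and
    -- the one beyond it must not carry the opposing arrow, which is `γ` of the arc.
    Right Left Half Both : History → Direction → Set
    Right h r = Clear h (end r) × Clear h (succ (end r))
    Left  h r = Clear h (pred (end r)) × Clear h (pred (pred (end r)))
    Half  h r = Right h r ⊎ Left h r
    Both  h r = Right h r × Left h r

    Kill : History → Direction → Set
    Kill h r = ∃[ i ] ∃[ s ] (Legal h (side i s) × s ≢ γ (arc i) × Dead (side i s ∷ h) r)

    -- Both arrows in `Dead` run against `γ` of their arcs. Across the end no neighbour can oppose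
    -- the move, because its opposing arrow would already have killed the end.
    kill : ∀ {h} r → Quiet h → ¬ Dead h r → Half h r → Kill h r
    kill {h} r Q ¬dead (inj₁ (cl , cl′)) =
      end r , r ⊙ c , legal-side (valid Q) (charged Q) unmarked
        (λ p → contradiction p (clear⇒∉ cl′ (arc-after r)))
        (λ p → contradiction (inj₂ p) ¬dead) ,
      (λ eq → flip-≢ (r ⊙ c) (sym (trans eq (cong γ (arc-end r))))) , inj₁ (here refl)
      where
      unmarked : Unmarked h (end r)
      unmarked t p with t ≟ᵈ r ⊙ c
      ... | yes refl = ¬dead (inj₁ p)
      ... | no ¬eq   = cl (subst (λ s → side _ s ∈ h)
                            (trans (≢⇒flip ¬eq) (cong γ (sym (arc-end r)))) p)
    kill {h} r Q ¬dead (inj₂ (cl , cl′)) =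
      pred (end r) , flip (r ⊙ c) , legal-side (valid Q) (charged Q) unmarked
        (λ p → contradiction (inj₁ (subst₂ (λ j s → side j s ∈ h)
                                           (succ-pred (end r)) (flip-involutive _) p)) ¬dead)
        (λ p → contradiction (subst (λ s → side _ s ∈ h)
                 (trans (flip-involutive _) (sym (γ-before (arc-pred² r)))) p) cl′) ,
      (λ eq → flip-≢ (r ⊙ c) (trans eq (γ-before (arc-pred r)))) , inj₂ (here refl)
      where
      γ-before : ∀ {q} → q ≡ flip r → γ q ≡ r ⊙ c
      γ-before refl = γ-flip r
      unmarked : Unmarked h (pred (end r))
      unmarked t p with t ≟ᵈ r ⊙ c
      ... | yes refl = cl (subst (λ s → side _ s ∈ h) (sym (γ-before (arc-pred r))) p)
      ... | no ¬eq   = ¬dead (inj₂ (subst (λ s → side _ s ∈ h) (≢⇒flip ¬eq) p))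

    harmless-quiet : ∀ {h i s} → Quiet h → Legal h (side i s) → s ≢ γ (arc i) →
                     Quiet (side i s ∷ h)
    harmless-quiet {h} {i} {s} Q L s≢γ = quiet-∷ Q L none
      where
      none : ∀ r j → ¬ Almost (side i s ∷ h) r j
      none r j al with arc i ≟ᵈ r
      ... | yes refl = spoilt (valid-∷ (valid Q) L) refl
                         (here (cong (side i) (sym (≢⇒flip s≢γ)))) al
      ... | no ¬eq   = noAlmost Q r j (almost (in-arc al) (unmarked-tail (free al))
        λ l eq l≢j → case rest al l eq l≢j of λ
          { (here refl) → contradiction eq ¬eq ; (there p) → p })

    both-dead : ∀ {h} r → Dead h r → Dead h (flip r) → ∀ q → Dead h q
    both-dead r d d̄ q with q ≟ᵈ r
    ... | yes refl = d
    ... | no ¬eq   = subst (Dead _) (sym (≢⇒flip ¬eq)) d̄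

    kill-second : ∀ {p h} r → Quiet h → Dead h r → Half h (flip r) →
      odd (blanks h) ≡ true → ¬ Cyclic h → toMove h ≡ p → Win p h
    kill-second {p} {h} r Q dead half odd-blanks ¬cyc mine with dead? h (flip r)
    ... | yes dead′ = settled-reply _ ℕₚ.≤-refl Q (both-dead r dead dead′) odd-blanks ¬cyc mine
    ... | no ¬dead  with kill (flip r) Q ¬dead half
    ...   | i , s , L , s≢γ , dead′ = reply mine ¬cyc _ L
      (settled-await _ ℕₚ.≤-refl (harmless-quiet Q L s≢γ)
        (both-dead r (dead-∷ r dead) dead′) (odd-∷ L odd-blanks) (cong opponent mine))

    -- The four sides nearest to `end r` are distinct because `n` is at least 4, so one arrow cannot
    -- disturb both pairs.
    half-left : ∀ {h} r i s → Both h r → Half (side i s ∷ h) r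
    half-left r i s ((c₁ , c₂) , (c₃ , c₄)) with i Finₚ.≟ end r | i Finₚ.≟ succ (end r)
    ... | no p | no q = inj₁ (clear-elsewhere (p ∘ sym) c₁ , clear-elsewhere (q ∘ sym) c₂)
    ... | yes refl | _ = inj₂
      ( clear-elsewhere (λ eq → succ≢ _ (trans eq (sym (succ-pred _)))) c₃
      , clear-elsewhere (λ eq → succ²≢ (pred (pred (end r)))
          (trans eq (sym (trans (cong succ (succ-pred _)) (succ-pred _))))) c₄ )
    ... | no _ | yes refl = inj₂
      ( clear-elsewhere (λ eq → succ²≢ (pred (end r)) (trans eq (cong succ (sym (succ-pred _))))) c₃
      , clear-elsewhere (λ eq → rotate-≢ 3 n≥4 (pred (pred (end r)))
          (sym (trans eq (cong succ (sym (trans (cong succ (succ-pred _)) (succ-pred _))))))) c₄ )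

    both-harmless : ∀ {h i s} r → s ≢ γ (arc i) → Both h r → Both (side i s ∷ h) r
    both-harmless r s≢γ ((c₁ , c₂) , (c₃ , c₄)) =
      (clear-harmless s≢γ c₁ , clear-harmless s≢γ c₂) ,
      (clear-harmless s≢γ c₃ , clear-harmless s≢γ c₄)

    -- Between the two kills the opponent has one arrow, which leaves `Half` of the room at the
    -- other end. The two moves together restore the parity.
    kill-first : ∀ {p h} r → Quiet h → Half h r → Both h (flip r) →
      odd (blanks h) ≡ true → ¬ Cyclic h → toMove h ≡ p → Win p h
    kill-first {p} {h} r Q half both odd-blanks ¬cyc mine with dead? h r
    ... | yes dead = kill-second r Q dead (inj₁ (proj₁ both)) odd-blanks ¬cyc mine
    ... | no ¬dead with kill r Q ¬dead half
    ...   | i , s , L , s≢γ , dead = reply mine ¬cyc _ L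
      (respond (harmless-quiet Q L s≢γ) (cong opponent mine) λ {j} {t} L′ Q′ ¬cyc′ mine′ →
        kill-second r Q′ (dead-∷ r dead)
          (half-left (flip r) j t (both-harmless (flip r) s≢γ both))
          (odd-∷ L′ (odd-∷ L odd-blanks)) ¬cyc′ mine′)

    -- Each arc has at least two sides, so a cell one arrow short already contains a `γ` arrow.
    all-clear⇒noAlmost : ∀ {h} → (∀ i → Clear h i) → ∀ r j → ¬ Almost h r j
    all-clear⇒noAlmost {h} clear r j al with end r Finₚ.≟ j
    ... | no e≢j   = clear⇒∉ (clear (end r)) (arc-end r) (rest al _ (arc-end r) e≢j)
    ... | yes refl = clear⇒∉ (clear (succ (end r))) (arc-after r)
                       (rest al _ (arc-after r) (succ≢ _ ∘ sym))

    Three : Direction → Set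
    Three r = succ (succ (succ (end r))) ≡ end (flip r)

    -- The other side of the arc cannot carry the opposite arrow, since that
    -- would make the vertex between them a sink or a source.
    pair-started : ∀ {h i} r → (∀ j → Clear h j) → succ (succ (end r)) ≡ end (flip r) →
      i ≡ end r ⊎ i ≡ succ (end r) → Legal h (side i (γ r)) → ¬ Quiet (side i (γ r) ∷ h)
    pair-started {h} r clear len (inj₁ refl) L Q = noAlmost Q r (succ (end r))
      (almost (arc-after r) unmarked λ l eq l≢ → case two-sides r len l eq of λ
        { (inj₁ refl) → here refl ; (inj₂ refl) → contradiction refl l≢ })
      where
      unmarked : Unmarked (side (end r) (γ r) ∷ h) (succ (end r))
      unmarked t (here eq) = succ≢ _ (sym (Finₚ.suc-injective (cong proj₁ eq)))
      unmarked t (there p) with t ≟ᵈ γ r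
      ... | yes refl = clear⇒∉ (clear _) (arc-after r) p
      ... | no ¬eq   = let (q , eq , _) = conflict (valid Q) (charged Q) (here refl)
                             (there (subst (λ x → side _ x ∈ h) (≢⇒flip ¬eq) p))
                       in end-gap r q eq
    pair-started {h} r clear len (inj₂ refl) L Q = noAlmost Q r (end r)
      (almost (arc-end r) unmarked λ l eq l≢ → case two-sides r len l eq of λ
        { (inj₁ refl) → contradiction refl l≢ ; (inj₂ refl) → here refl })
      where
      unmarked : Unmarked (side (succ (end r)) (γ r) ∷ h) (end r)
      unmarked t (here eq) = succ≢ _ (Finₚ.suc-injective (cong proj₁ eq))
      unmarked t (there p) with t ≟ᵈ γ r
      ... | yes refl = clear⇒∉ (clear _) (arc-end r) p
      ... | no ¬eq   = let (q , eq , _) = conflict (valid Q) (charged Q)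
                             (there (subst (λ x → side _ x ∈ h) (≢⇒flip ¬eq) p))
                             (here (cong (side _) (flip-involutive _)))
                       in end-gap r q eq

    -- While no side is marked γ, the hero can still kill each end from either
    -- side of it; one arrow of the opponent can prevent this on one side of both
    -- ends only if it is in the middle of an arc of three sides.
    fresh-await : ∀ {p h} → Quiet h → (∀ i → Clear h i) → odd (blanks h) ≡ false →
      toMove h ≡ opponent p →
      (∀ r → Three r → Legal h (side (succ (end r)) (γ r)) →
        let h′ = side (succ (end r)) (γ r) ∷ h in
        Quiet h′ → ¬ Cyclic h′ → toMove h′ ≡ p → Win p h′) →
      Win p h
    fresh-await {p} {h} Q clear even theirs trap = respond Q theirs go
      where
      both : ∀ {g} → (∀ i → Clear g i) → ∀ r → Both g r
      both cl r = (cl _ , cl _) , (cl _ , cl _)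

      go : ∀ {i s} → Legal h (side i s) → Quiet (side i s ∷ h) → ¬ Cyclic (side i s ∷ h) →
           toMove (side i s ∷ h) ≡ p → Win p (side i s ∷ h)
      go {i} {s} L Q′ ¬cyc mine with s ≟ᵈ γ (arc i)
      ... | no s≢γ = kill-first fwd Q′ (inj₁ (proj₁ (both cl fwd))) (both cl bwd)
                       (odd-∷ L even) ¬cyc mine
        where
        cl : ∀ j → Clear (side i s ∷ h) j
        cl j = clear-harmless s≢γ (clear j)
      ... | yes refl = spoil (arc i) refl L Q′ ¬cyc mine
        where
        spoil : ∀ {i} r → arc i ≡ r → Legal h (side i (γ r)) → Quiet (side i (γ r) ∷ h) →
          ¬ Cyclic (side i (γ r) ∷ h) → toMove (side i (γ r) ∷ h) ≡ p →
          Win p (side i (γ r) ∷ h)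
        spoil {i} r arc-i L Q′ ¬cyc mine =
          locate (i Finₚ.≟ end r) (i Finₚ.≟ succ (end r))
                 (i Finₚ.≟ pred (end (flip r))) (i Finₚ.≟ pred (pred (end (flip r))))
          where
          h′ = side i (γ r) ∷ h

          away : ∀ {j} → arc j ≡ flip r → Clear h′ j
          away eq = clear-elsewhere
            (λ j≡i → flip-≢ r (trans (sym eq) (trans (cong arc j≡i) arc-i))) (clear _)

          spare : ∀ {j} → i ≢ j → Clear h′ j
          spare i≢j = clear-elsewhere (i≢j ∘ sym) (clear _)

          left-r : Left h′ r
          left-r = away (arc-pred r) , away (arc-pred² r)

          right-r̄ : Right h′ (flip r)
          right-r̄ = away (arc-end (flip r)) , away (arc-after (flip r))

          follows : ∀ {j k} → j ≡ pred k → succ j ≡ k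
          follows eq = trans (cong succ eq) (succ-pred _)

          near-r̄ : i ≢ pred (end (flip r)) → i ≢ pred (pred (end (flip r))) → Win p h′
          near-r̄ p₁ p₂ = kill-first r Q′ (inj₂ left-r) (right-r̄ , spare p₁ , spare p₂)
                           (odd-∷ L even) ¬cyc mine

          -- The arrow can affect only `Right` at `r` and `Left` at `flip r`. If one of these is
          -- intact, the hero kills the other end first, from outside arc `r`. Otherwise `i` is near
          -- both ends, and arc `r` has one, two or three sides.
          locate : Dec (i ≡ end r) → Dec (i ≡ succ (end r)) →
            Dec (i ≡ pred (end (flip r))) → Dec (i ≡ pred (pred (end (flip r)))) → Win p h′
          locate (no p₁) (no p₂) _ _ = kill-first (flip r) Q′ (inj₁ right-r̄)
            (subst (Both h′) (sym (flip-involutive r)) ((spare p₁ , spare p₂) , left-r))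
            (odd-∷ L even) ¬cyc mine
          locate _ _ (no q₁) (no q₂) = near-r̄ q₁ q₂
          locate (yes refl) _ (yes q₁) _ = contradiction (follows q₁) (end-gap r (flip r))
          locate (yes refl) _ _ (yes q₂) = contradiction Q′
            (pair-started r clear (follows (follows q₂)) (inj₁ refl) L)
          locate _ (yes refl) (yes q₁) _ = contradiction Q′
            (pair-started r clear (follows q₁) (inj₂ refl) L)
          locate _ (yes refl) _ (yes q₂) = trap r (follows (follows q₂)) L Q′ ¬cyc mine

    -- Mirroring play around an arc of three sides.

    mirror : Fin n → Fin n
    mirror = ρ a b

    mirror-end : ∀ r → mirror (end r) ≡ pred (end (flip r))
    mirror-end fwd = ρ-start a b
    mirror-end bwd = ρ-end a b

    mirror-involutive : ∀ i → mirror (mirror i) ≡ i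
    mirror-involutive = ρ-involutive a b

    same-sign : ∀ {h i j s} → Valid h → chord c ∈ h → succ i ≡ j → (∀ q → j ≢ end q) →
      side i s ∈ h → ∀ {t} → side j t ∈ h → s ≡ t
    same-sign {s = s} v c∈h refl ¬end p {t} q with t ≟ᵈ flip s
    ... | yes refl = let (e , eq , _) = conflict v c∈h p q in contradiction eq (¬end e)
    ... | no t≢    = sym (trans (≢⇒flip t≢) (flip-involutive s))

    module ThreeSides (r : Direction) (three : Three r) where

      u₀ u₁ u₂ : Fin n
      u₀ = end r
      u₁ = succ u₀
      u₂ = succ u₁

      mirror-u₀ : mirror u₀ ≡ u₂
      mirror-u₀ = trans (mirror-end r) (trans (cong pred (sym three)) (pred-succ u₂))

      mirror-u₁ : mirror u₁ ≡ u₁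
      mirror-u₁ = trans (ρ-succ a b u₀) (trans (cong pred mirror-u₀) (pred-succ u₁))

      mirror-u₂ : mirror u₂ ≡ u₀
      mirror-u₂ = trans (cong mirror (sym mirror-u₀)) (mirror-involutive u₀)

      u₂-inner : ∀ q → u₂ ≢ end q
      u₂-inner q eq = end-gap q (flip r) (trans (cong succ (sym eq)) three)

      arc-u₂ : arc u₂ ≡ r
      arc-u₂ = trans (arc-succ u₂-inner) (arc-after r)

      arc-mirror : ∀ {i} → arc (mirror i) ≡ r → arc i ≡ r
      arc-mirror {i} eq = case three-sides r three (mirror i) eq of λ
        { (inj₁ p)        → trans (unmirror p mirror-u₀) arc-u₂
        ; (inj₂ (inj₁ p)) → trans (unmirror p mirror-u₁) (arc-after r)
        ; (inj₂ (inj₂ p)) → trans (unmirror p mirror-u₂) (arc-end r) }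
        where
        unmirror : ∀ {u w} → mirror i ≡ u → mirror u ≡ w → arc i ≡ arc w
        unmirror p q = cong arc (trans (sym (mirror-involutive i)) (trans (cong mirror p) q))

      -- The sides `u₀` and `u₂` meet `u₁` at vertices that are not ends, where consecutive arrows
      -- agree.
      neighbours : ∀ {h s} → Valid h → chord c ∈ h → side u₁ (γ r) ∈ h →
        (side u₀ s ∈ h → s ≡ γ r) × (side u₂ s ∈ h → s ≡ γ r)
      neighbours v c∈h middle∈ =
        (λ p → same-sign v c∈h refl (end-gap r) p middle∈) ,
        (λ p → sym (same-sign v c∈h refl u₂-inner middle∈ p))

      -- Whoever marks one of the sides u₀ and u₂ lets the other player complete
      -- the cell, and all other moves can be mirrored.
      record Palindrome (h : History) : Set where
        field
          middle    : side u₁ (γ r) ∈ h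
          free₀     : Unmarked h u₀
          free₂     : Unmarked h u₂
          symmetric : ∀ {i s} → side i s ∈ h → side (mirror i) s ∈ h
          axis      : ∀ {i} → mirror i ≡ i → ¬ Unmarked h i

      open Palindrome

      -- Arc `r` lacks both `u₀` and `u₂`. In the other arc an unmarked side has an unmarked mirror
      -- image, distinct from it by `axis`, so never exactly one side is missing.
      palindrome-quiet : ∀ {h} → Valid h → chord c ∈ h → Palindrome h → Quiet h
      palindrome-quiet {h} v c∈h P = record { valid = v ; charged = c∈h ; noAlmost = none }
        where
        none : ∀ q j → ¬ Almost h q j
        none q j al with q ≟ᵈ r | j Finₚ.≟ u₀
        ... | yes refl | yes refl = free₂ P _ (rest al u₂ arc-u₂ (succ²≢ u₀ ∘ sym))
        ... | yes refl | no j≢    = free₀ P _ (rest al u₀ (arc-end r) (j≢ ∘ sym))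
        ... | no q≢r   | _        = free al _ (subst (λ i → side i (γ q) ∈ h) (mirror-involutive j)
          (symmetric P (rest al (mirror j) in-q λ eq → axis P eq (free al))))
          where
          in-q : arc (mirror j) ≡ q
          in-q with arc (mirror j) ≟ᵈ r
          ... | yes eq = contradiction (trans (sym (in-arc al)) (arc-mirror eq)) q≢r
          ... | no ¬eq = trans (≢⇒flip ¬eq) (sym (≢⇒flip q≢r))

      outer-spoilt : ∀ {h i s} → Palindrome h → Legal h (side i s) → Quiet (side i s ∷ h) →
        i ≢ u₀ × i ≢ u₂
      outer-spoilt {h} {i} {s} P L Q = not₀ , not₂
        where
        not₀ : i ≢ u₀
        not₀ refl with proj₁ (neighbours (valid Q) (charged Q) (there (middle P))) (here refl)
        ... | refl = noAlmost Q r u₂ (almost arc-u₂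
          (λ { t (here eq) → succ²≢ u₀ (sym (Finₚ.suc-injective (cong proj₁ eq)))
             ; t (there p) → free₂ P t p })
          λ l eq l≢ → case three-sides r three l eq of λ
            { (inj₁ refl) → here refl ; (inj₂ (inj₁ refl)) → there (middle P)
            ; (inj₂ (inj₂ refl)) → contradiction refl l≢ })
        not₂ : i ≢ u₂
        not₂ refl with proj₂ (neighbours (valid Q) (charged Q) (there (middle P))) (here refl)
        ... | refl = noAlmost Q r u₀ (almost (arc-end r)
          (λ { t (here eq) → succ²≢ u₀ (Finₚ.suc-injective (cong proj₁ eq))
             ; t (there p) → free₀ P t p })
          λ l eq l≢ → case three-sides r three l eq of λ
            { (inj₁ refl) → contradiction refl l≢ ; (inj₂ (inj₁ refl)) → there (middle P)
            ; (inj₂ (inj₂ refl)) → here refl })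

      -- Keeping `s` amounts to reflecting the board and reversing all arrows, which preserves the
      -- chord's arrow and exchanges sinks with sources. An opposing neighbour thus reflects to one
      -- of the opponent's move, where `conflict` places it at an end.
      mirror-legal : ∀ {h i s} → Palindrome h → Legal h (side i s) → Quiet (side i s ∷ h) →
                     Legal (side i s ∷ h) (side (mirror i) s)
      mirror-legal {h} {i} {s} P L Q =
        legal-side (valid Q) (charged Q) unmarked ahead behind
        where
        unmarked : Unmarked (side i s ∷ h) (mirror i)
        unmarked t (here eq) = axis P (Finₚ.suc-injective (cong proj₁ eq)) (legal⇒unmarked L)
        unmarked t (there p) = legal⇒unmarked L t
          (subst (λ j → side j t ∈ h) (mirror-involutive i) (symmetric P p))

        ahead : side (succ (mirror i)) (flip s) ∈ side i s ∷ h →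
                ∃[ q ] (succ (mirror i) ≡ end q × s ≡ q ⊙ c)
        ahead (here eq) = contradiction (cong proj₂ eq) (flip-≢ s)
        ahead (there p) with conflict (valid Q) (charged Q)
          (there (subst (λ j → side j (flip s) ∈ h)
            (trans (ρ-succ a b (mirror i)) (cong pred (mirror-involutive i))) (symmetric P p)))
          (here (cong₂ side′ (succ-pred i) (flip-involutive s)))
          where
          side′ : Fin n → Direction → Dart
          side′ j t = side j t
        ... | q , eq , s≡ = flip q ,
          trans (cong (succ ∘ mirror) (trans (sym (succ-pred i)) eq))
            (trans (cong succ (mirror-end q)) (succ-pred _)) ,
          trans (sym (flip-involutive s)) (trans (cong flip s≡) (sym (⊙-flipˡ q c)))

        behind : side (pred (mirror i)) (flip s) ∈ side i s ∷ h →
                 ∃[ q ] (mirror i ≡ end q × flip s ≡ q ⊙ c)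
        behind (here eq) = contradiction (cong proj₂ eq) (flip-≢ s)
        behind (there p) with conflict (valid Q) (charged Q) (here refl)
          (there (subst (λ j → side j (flip s) ∈ h)
            (trans (ρ-pred a b (mirror i)) (cong succ (mirror-involutive i))) (symmetric P p)))
        ... | q , eq , refl = flip q ,
          trans (sym (succ-pred _)) (trans (cong succ (trans (sym (ρ-succ a b i))
            (trans (cong mirror eq) (mirror-end q)))) (succ-pred _)) ,
          sym (⊙-flipˡ q c)

      mirror-palindrome : ∀ {h i s} → Palindrome h → i ≢ u₀ → i ≢ u₂ →
                          Palindrome (side (mirror i) s ∷ side i s ∷ h)
      mirror-palindrome {h} {i} {s} P i≢u₀ i≢u₂ = record
        { middle    = there (there (middle P))
        ; free₀     = still (i≢u₂ ∘ reflected mirror-u₀) i≢u₀ (free₀ P)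
        ; free₂     = still (i≢u₀ ∘ reflected mirror-u₂) i≢u₂ (free₂ P)
        ; symmetric = λ
          { (here refl)         → there (here (cong (λ j → side j s) (mirror-involutive i)))
          ; (there (here refl)) → here refl
          ; (there (there p))   → there (there (symmetric P p)) }
        ; axis      = λ fix u → axis P fix (unmarked-tail (unmarked-tail u)) }
        where
        reflected : ∀ {u w} → mirror u ≡ w → mirror i ≡ u → i ≡ w
        reflected eq eq′ = trans (sym (mirror-involutive i)) (trans (cong mirror eq′) eq)
        still : ∀ {u} → mirror i ≢ u → i ≢ u → Unmarked h u →
                Unmarked (side (mirror i) s ∷ side i s ∷ h) u
        still ne ne′ un t (here eq)         = ne (sym (Finₚ.suc-injective (cong proj₁ eq)))
        still ne ne′ un t (there (here eq)) = ne′ (sym (Finₚ.suc-injective (cong proj₁ eq)))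
        still ne ne′ un t (there (there p)) = un t p

      palindrome-await : ∀ {p} m {h} → blanks h ℕ.≤ m → Valid h → chord c ∈ h →
        Palindrome h → toMove h ≡ opponent p → Win p h
      palindrome-await {p} m {h} le v c∈h P theirs = respond (palindrome-quiet v c∈h P) theirs go
        where
        go : ∀ {i s} → Legal h (side i s) → Quiet (side i s ∷ h) → ¬ Cyclic (side i s ∷ h) →
             toMove (side i s ∷ h) ≡ p → Win p (side i s ∷ h)
        go {i} {s} L Q ¬cyc mine =
          descend m (subst (ℕ._≤ m) (trans (blanks-∷ (legal⇒unmarked L))
                                           (cong suc (blanks-∷ {s = s} (legal⇒unmarked L′)))) le)
          where
          L′ : Legal (side i s ∷ h) (side (mirror i) s)
          L′ = mirror-legal P L Q
          descend : ∀ m → 2 + blanks (side (mirror i) s ∷ side i s ∷ h) ℕ.≤ m →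
                    Win p (side i s ∷ h)
          descend (suc (suc m)) (ℕ.s≤s (ℕ.s≤s le)) = reply mine ¬cyc _ L′
            (palindrome-await m le (valid-∷ (valid Q) L′) (there (charged Q))
              (mirror-palindrome P (proj₁ (outer-spoilt P L Q)) (proj₂ (outer-spoilt P L Q)))
              (cong opponent mine))

      -- The hero's entry into the mirroring phase, for both parities: `x` is either a second side
      -- on the axis or the mirror image of the one other marked side.
      symmetrize : ∀ {p h} x t → Quiet h → ¬ Cyclic h → toMove h ≡ p → side u₁ (γ r) ∈ h →
        (∀ {i s} → side i s ∈ h → i ≡ u₁ ⊎ (i ≡ mirror x × s ≡ t)) →
        x ≢ u₀ → x ≢ u₂ → Unmarked h x →
        side (mirror x) t ∈ side x t ∷ h →
        (∀ {i} → mirror i ≡ i → i ≡ u₁ ⊎ i ≡ x) → Win p h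
      symmetrize {p} {h} x t Q ¬cyc mine middle∈ marks x≢u₀ x≢u₂ ux mx∈ axes =
        reply mine ¬cyc _ L (palindrome-await _ ℕₚ.≤-refl (valid-∷ (valid Q) L)
          (there (charged Q)) P (cong opponent mine))
        where
        L : Legal h (side x t)
        L = legal-side (valid Q) (charged Q) ux
          (λ p → case marks p of λ
            { (inj₁ eq) → contradiction (succ-injective eq) x≢u₀
            ; (inj₂ (_ , eq)) → contradiction eq (flip-≢ t) })
          (λ p → case marks p of λ
            { (inj₁ eq) → contradiction (trans (sym (succ-pred x)) (cong succ eq)) x≢u₂
            ; (inj₂ (_ , eq)) → contradiction eq (flip-≢ t) })
        reflected : ∀ {u w} → mirror u ≡ w → u ≡ mirror x → x ≡ w
        reflected eq eq′ = trans (sym (mirror-involutive x)) (trans (cong mirror (sym eq′)) eq)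
        outer : ∀ {u} → u ≢ u₁ → x ≢ u → x ≢ mirror u → Unmarked (side x t ∷ h) u
        outer u≢u₁ x≢u x≢mu s (here eq) = x≢u (sym (Finₚ.suc-injective (cong proj₁ eq)))
        outer u≢u₁ x≢u x≢mu s (there p) = case marks p of λ
          { (inj₁ eq) → u≢u₁ eq ; (inj₂ (eq , _)) → x≢mu (reflected refl eq) }
        P : Palindrome (side x t ∷ h)
        P = record
          { middle    = there middle∈
          ; free₀     = outer (succ≢ u₀) x≢u₀ (subst (x ≢_) (sym mirror-u₀) x≢u₂)
          ; free₂     = outer (succ≢ u₁ ∘ sym) x≢u₂ (subst (x ≢_) (sym mirror-u₂) x≢u₀)
          ; symmetric = λ
            { (here refl) → mx∈
            ; {i} {s} (there p) → case marks p of λ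
              { (inj₁ refl) → subst (λ j → side j s ∈ _) (sym mirror-u₁) (there p)
              ; (inj₂ (refl , refl)) → here (cong (λ j → side j t) (mirror-involutive x)) } }
          ; axis      = λ fix u → case axes fix of λ
            { (inj₁ refl) → u _ (there middle∈) ; (inj₂ refl) → u _ (here refl) } }

      off-axis : u₀ ≢ mirror u₀ × u₂ ≢ mirror u₂
      off-axis = (λ eq → succ²≢ u₀ (trans eq mirror-u₀)) ,
                 (λ eq → succ²≢ u₀ (sym (trans eq mirror-u₂)))

    -- For even `n` the axis meets two sides, `u₁` and the opposite one. The hero marks the latter,
    -- and either direction is symmetric.
    trap-even : ∀ {p} r (three : Three r) m → n ≡ m * 2 →
      let h = side (succ (end r)) (γ r) ∷ chord c ∷ [] in
      Quiet h → ¬ Cyclic h → toMove h ≡ p → Win p h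
    trap-even r three m n≡ Q ¬cyc mine =
      symmetrize x fwd Q ¬cyc mine (here refl)
        (λ { (here refl) → inj₁ refl ; (there (here ())) })
        (λ eq → proj₁ off-axis (trans (sym eq) (trans (sym fixed) (cong mirror eq))))
        (λ eq → proj₂ off-axis (trans (sym eq) (trans (sym fixed) (cong mirror eq))))
        (λ { s (here eq) → x≢u₁ (Finₚ.suc-injective (cong proj₁ eq)) ; s (there (here ())) })
        (here (cong (λ j → side j fwd) fixed))
        (λ fix → ρ-fixed-even a b m n≡ mirror-u₁ fix)
      where
      open ThreeSides r three
      x = rotate m u₁
      fixed : mirror x ≡ x
      fixed = antipode-fixed a b m n≡ mirror-u₁
      x≢u₁ : x ≢ u₁
      x≢u₁ = rotate-half-≢ m n≡ u₁

    -- For odd `n` only `u₁` is on the axis, and the hero mirrors the opening arrow on `f`. That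
    -- side is not `u₀` or `u₂`, which could carry only `γ r` beside the marked `u₁`.
    trap-odd : ∀ {p} r (three : Three r) f s → ¬ 2 ∣ n → s ≢ γ (arc f) →
      let h = chord c ∷ side f s ∷ [] ; h′ = side (succ (end r)) (γ r) ∷ h in
      Legal h (side (succ (end r)) (γ r)) → Quiet h′ → ¬ Cyclic h′ →
      toMove h′ ≡ p → Win p h′
    trap-odd r three f s n-odd s≢γ L Q ¬cyc mine =
      symmetrize (mirror f) s Q ¬cyc mine (here refl)
        (λ { (here refl) → inj₁ refl ; (there (here ()))
           ; (there (there (here refl))) → inj₂ (sym (mirror-involutive f) , refl) })
        (λ eq → f≢u₂ (unmirror eq mirror-u₀)) (λ eq → f≢u₀ (unmirror eq mirror-u₂))
        (λ { t (here eq) → f≢u₁ (unmirror (Finₚ.suc-injective (cong proj₁ eq)) mirror-u₁)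
           ; t (there (here ()))
           ; t (there (there (here eq))) → f≢u₁ (ρ-fixed-odd a b n-odd
               (Finₚ.suc-injective (cong proj₁ eq)) mirror-u₁) })
        (there (there (there (here (cong (λ j → side j s) (mirror-involutive f))))))
        (λ fix → inj₁ (ρ-fixed-odd a b n-odd fix mirror-u₁))
      where
      open ThreeSides r three
      unmirror : ∀ {u w} → mirror f ≡ u → mirror u ≡ w → f ≡ w
      unmirror p q = trans (sym (mirror-involutive f)) (trans (cong mirror p) q)
      arrows : ∀ {t} → _
      arrows {t} = neighbours {s = t} (valid Q) (charged Q) (here refl)
      f≢u₀ : f ≢ u₀
      f≢u₀ refl = s≢γ (trans (proj₁ arrows (there (there (here refl)))) (cong γ (sym (arc-end r))))
      f≢u₁ : f ≢ u₁
      f≢u₁ refl = legal⇒unmarked L s (there (here refl))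
      f≢u₂ : f ≢ u₂
      f≢u₂ refl = s≢γ (trans (proj₂ arrows (there (there (here refl)))) (cong γ (sym arc-u₂)))

  -- The openings.

  chord-legal : ∀ {h c} → Valid h → (∀ q → chord q ∉ h) →
    (∀ v s t → side v s ∉ h ⊎ side (pred v) t ∉ h) → Legal h (chord c)
  chord-legal {h} {c} v chord∉ free = legal-by-witnesses v (chord∉ c) (chord∉ (flip c)) into outof
    where
    into : ∃[ e ] (tgt e ≡ tgt (chord c) × e ≢ chord c × e ∉ h)
    into with free (tgt (chord c)) bwd fwd
    ... | inj₁ ∉h = side _ bwd , refl , (λ ()) , ∉h
    ... | inj₂ ∉h = side _ fwd , succ-pred _ , (λ ()) , ∉h
    outof : ∃[ e ] (src e ≡ src (chord c) × e ≢ chord c × e ∉ h)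
    outof with free (src (chord c)) fwd bwd
    ... | inj₁ ∉h = side _ fwd , refl , (λ ()) , ∉h
    ... | inj₂ ∉h = side _ bwd , succ-pred _ , (λ ()) , ∉h

  cyclic⇒chord : ∀ {h} → Cyclic h → ∃[ q ] chord q ∈ h
  cyclic⇒chord (zero     , inj₁ f) = bwd , f (chord bwd) refl
  cyclic⇒chord (zero     , inj₂ f) = fwd , f (chord bwd) refl
  cyclic⇒chord (suc zero , inj₁ f) = fwd , f (chord fwd) refl
  cyclic⇒chord (suc zero , inj₂ f) = bwd , f (chord fwd) refl

  blanks-[] : blanks [] ≡ n
  blanks-[] = trans (count-cong λ i → dec-true (unmarked? [] i) λ _ ()) (count-true n)

  blanks-chord : ∀ c h → blanks (chord c ∷ h) ≡ blanks h
  blanks-chord c h = count-cong λ i → does-⇔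
    (mk⇔ unmarked-tail λ { u s (here ()) ; u s (there p) → u s p })
    (unmarked? (chord c ∷ h) i) (unmarked? h i)

  opening-legal : ∀ {c} → Legal [] (chord c)
  opening-legal = chord-legal valid-[] (λ _ ()) λ _ _ _ → inj₁ λ ()

  unfinished : ¬ Finished []
  unfinished (inj₁ cyc)   = case proj₂ (cyclic⇒chord cyc) of λ ()
  unfinished (inj₂ stuck) = stuck (chord fwd) opening-legal

  module _ (c : Direction) where

    open Marked c

    chord-quiet : ∀ {h} → Valid (chord c ∷ h) → (∀ i → Clear h i) → Quiet (chord c ∷ h)
    chord-quiet v clear = record { valid = v ; charged = here refl ; noAlmost =
      all-clear⇒noAlmost λ { i (there p) → clear i p } }

    chord-acyclic : ∀ {h} → Valid (chord c ∷ h) → (∀ i → Clear h i) → ¬ Cyclic (chord c ∷ h)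
    chord-acyclic v clear cyc with cyclic⇒full v (here refl) cyc
    ... | r , full with full (end r) (arc-end r)
    ...   | there p = clear⇒∉ (clear (end r)) (arc-end r) p

  first-wins : ∀ m → n ≡ m * 2 → odd n ≡ false → Win player₁ []
  first-wins m n≡ even = reply refl (λ cyc → case proj₂ (cyclic⇒chord cyc) of λ ()) (chord fwd)
    opening-legal
    (fresh-await (chord-quiet fwd (valid-∷ valid-[] opening-legal) λ _ ())
      (λ { i (here ()) ; i (there ()) })
      (trans (cong odd (trans (blanks-chord fwd []) blanks-[])) even) refl
      λ r three _ → trap-even r three m n≡)
    where open Marked fwd

  second-wins : ¬ 2 ∣ n → odd n ≡ true → Win player₂ []
  second-wins n-odd odd-n = await refl λ
    -- With all sides unmarked, an odd number of them, the hero can start killing at once.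
    { (chord c) _ L → let open Marked c in
        kill-first fwd (chord-quiet c (valid-∷ valid-[] L) λ _ ())
          (inj₁ ((λ { (here ()) ; (there ()) }) , λ { (here ()) ; (there ()) }))
          (((λ { (here ()) ; (there ()) }) , λ { (here ()) ; (there ()) }) ,
           ((λ { (here ()) ; (there ()) }) , λ { (here ()) ; (there ()) }))
          (trans (cong odd (trans (blanks-chord c []) blanks-[])) odd-n)
          (chord-acyclic c (valid-∷ valid-[] L) λ _ ()) refl
    ; (side f s) _ L → after-side f s L }
    where
    after-side : ∀ f s → Legal [] (side f s) → Win player₂ (side f s ∷ [])
    after-side f s L = reply refl
      (λ cyc → case proj₂ (cyclic⇒chord cyc) of λ { (here ()) ; (there ()) }) (chord c) L′
      (fresh-await Q (λ { i (here ()) ; i (there p) → clear i p })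
        (trans (cong odd (blanks-chord c (side f s ∷ [])))
          (odd-∷ L (trans (cong odd blanks-[]) odd-n))) refl
        λ r three L″ → trap-odd r three f s n-odd s≢γ L″)
      where
      -- Chosen so that `γ (arc f)` is `flip s`: the opening arrow then runs against the cycle of
      -- its cell.
      c = arc f ⊙ s
      open Marked c
      v = valid-∷ valid-[] L
      s≢γ : s ≢ γ (arc f)
      s≢γ eq = flip-≢ s (sym (trans eq (cong flip (⊙-involutive (arc f) s))))
      clear : ∀ i → Clear (side f s ∷ []) i
      clear i (here eq) = s≢γ (trans (sym (cong proj₂ eq))
                                     (cong (γ ∘ arc) (Finₚ.suc-injective (cong proj₁ eq))))
      L′ : Legal (side f s ∷ []) (chord c)
      L′ = chord-legal v (λ { q (here ()) ; q (there ()) }) λ w x y → case w Finₚ.≟ f of λ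
        { (yes refl) → inj₂ λ { (here eq) → succ≢ (pred w)
            (trans (Finₚ.suc-injective (cong proj₁ eq)) (sym (succ-pred w))) ; (there ()) }
        ; (no w≢f) → inj₁ λ
          { (here eq) → w≢f (Finₚ.suc-injective (cong proj₁ eq)) ; (there ()) } }
      Q : Quiet (chord c ∷ side f s ∷ [])
      Q = chord-quiet c (valid-∷ v L′) clear

theorem4p4 : (n : ℕ) → 4 ≤ n →
    (a b : Fin n) (a<b : a < b) (nonadjacent : ¬ CycleAdjacent a b) →
    let B = chordBoard n a b a<b nonadjacent in
    (2 ∣ n → HasWinningStrategy B player₁) ×
    (¬ 2 ∣ n → HasWinningStrategy B player₂)
theorem4p4 n n≥4 a b a<b nonadjacent =
  (λ { (divides m eq) → winning (first-wins m eq (trans (cong odd eq) (odd-*2 m))) unfinished }) ,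
  (λ n-odd → winning (second-wins n-odd (¬∣⇒odd n n-odd)) unfinished)
  where
  open Play (chordBoard n a b a<b nonadjacent)
  open Chorded n n≥4 a b a<b nonadjacent
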